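{- As linear maps $\mathcal H_{CK}\to\mathcal H\otimes\mathcal H_{CK}\otimes\mathcal H_{CK}$, $$(\mathrm{Id}_{\mathcal H}\otimes\Delta_{CK})\circ\Phi=m^{1,3}\circ(\Phi\otimes\Phi)\circ\Delta_{CK},$$ where $m^{1,3}(a\otimes b\otimes c\otimes d)=ac\otimes b\otimes d$ for $a,c\in\mathcal H$, $b,d\in\mathcal H_{CK}$.
   Context: Let $k$ be a field of characteristic $0$. Rooted trees are finite and non-planar; $\bullet$ denotes the one-vertex tree. (1) Let $\mathcal H$ be the free commutative $k$-algebra generated by isomorphism classes of rooted trees with at least one edge, with unit identified with $\bullet$. A subforest of a rooted tree $t$ is either the trivial subforest $\bullet$ or a nonempty set of pairwise vertex-disjoint subtrees of $t$ each with at least one edge, identified with the product of its components in $\mathcal H$; $t/s$ is the rooted tree obtained by contracting each component of $s$ to a single vertex ($t/\bullet=t$, $t/t=\bullet$). $\mathcal H$ is a Hopf algebra with the multiplicative coproduct $\Delta(t)=\sum_s s\otimes t/s$ over subforests $s$ of $t$ (as subsets of $t$). (2) $\mathcal H_{CK}$ (Connes–Kreimer) is the free commutative $k$-algebra generated by isomorphism classes of nonempty rooted trees (including $\bullet$); monomials are rooted forests, the unit is the empty forest $\mathbf 1$. For a forest $u$ with vertex set $U$, partially ordered by $x\le y$ iff the path from a root to $y$ passes through $x$, $\Delta_{CK}(u)=\sum v\otimes w$, the sum over all ordered decompositions $U=V\sqcup W$ (either part may be empty) such that no vertex of $V$ is strictly below a vertex of $W$, where $v,w$ are the forests induced on $V,W$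 (keeping edges joining two vertices of the same part). (3) $\Phi:\mathcal H_{CK}\to\mathcal H\otimes\mathcal H_{CK}$ is the algebra morphism with $\Phi(\mathbf 1)=\bullet\otimes\mathbf 1$ and, for every nonempty rooted tree $t$, $\Phi(t)=\sum_s s\otimes t/s$ over all subforests $s$ of $t$, with $s\in\mathcal H$ and $t/s$ regarded as a tree in $\mathcal H_{CK}$ (e.g. $\Phi(\bullet)=\bullet\otimes\bullet$). -}

module Defs where

open import Algebra.Apartness.Bundles using (HeytingField)
open import Algebra.Bundles using (CommutativeMonoid; CommutativeRing)
open import Algebra.Definitions.RawMonoid using () renaming (_×_ to multiple)
open import Algebra.Module.Bundles using (LeftModule)
open import Algebra.Module.Morphism.Structures using (module LeftModuleMorphisms)
import Algebra.Module.Properties.LeftModule as LeftModuleProperties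
open import Algebra.Structures using (IsCommutativeMonoid)
open import Data.Bool.Base using (true; false; if_then_else_)
open import Data.List.Base
  using (List; []; _∷_; [_]; _++_; map; foldr; concatMap; filter; cartesianProductWith)
open import Data.List.Relation.Binary.Permutation.Homogeneous
  using (Permutation)
import Data.List.Relation.Binary.Permutation.Homogeneous as Homogeneous
import Data.List.Relation.Binary.Permutation.Setoid as PermutationSetoid
import Data.List.Relation.Binary.Permutation.Setoid.Properties as PermutationProperties
open import Data.List.Relation.Binary.Pointwise.Base using (Pointwise; []; _∷_)
open import Data.Product.Base using (Σ; _×_; _,_; proj₁)
open import Data.Unit.Base using (⊤; tt)
open import Function.Base using (_∘_; id)
open import Level using (_⊔_; 0ℓ) renaming (suc to lsuc)
open import Relation.Binary.Bundles using (Setoid)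
open import Relation.Binary.Core using (Rel)
import Relation.Binary.Construct.On as On
open import Relation.Binary.Definitions using (DecidableEquality)
open import Relation.Binary.PropositionalEquality.Core as ≡ using (_≡_)
import Relation.Binary.Reasoning.Setoid as SetoidReasoning
open import Relation.Nullary
  using (¬_; Dec; yes; no; does; _because_; contradiction)
open import Relation.Nullary.Decidable using (map′; _×-dec_; ¬?)
open import Relation.Unary using (Decidable)

fieldRing : ∀ {c ℓ₁ ℓ₂} → HeytingField c ℓ₁ ℓ₂ → CommutativeRing c ℓ₁
fieldRing K = record { isCommutativeRing = HeytingField.isCommutativeRing K }

CharacteristicZero : ∀ {c ℓ₁ ℓ₂} → HeytingField c ℓ₁ ℓ₂ → Set ℓ₁
CharacteristicZero K = ∀ n → multiple +-rawMonoid n 1# ≈ 0# → n ≡ 0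
  where open CommutativeRing (fieldRing K)

------------------------------------------------------------------------
-- Finite sums in a commutative monoid

module Summation {m ℓm} (M : CommutativeMonoid m ℓm) where
  open CommutativeMonoid M
  open SetoidReasoning setoid

  ∑ : ∀ {a} {A : Set a} → List A → (A → Carrier) → Carrier
  ∑ xs φ = foldr _∙_ ε (map φ xs)

  interchange : ∀ a b c d → (a ∙ b) ∙ (c ∙ d) ≈ (a ∙ c) ∙ (b ∙ d)
  interchange a b c d = begin
    (a ∙ b) ∙ (c ∙ d)  ≈⟨ assoc a b _ ⟩
    a ∙ (b ∙ (c ∙ d))  ≈⟨ ∙-congˡ (assoc b c d) ⟨
    a ∙ ((b ∙ c) ∙ d)  ≈⟨ ∙-congˡ (∙-congʳ (comm b c)) ⟩
    a ∙ ((c ∙ b) ∙ d)  ≈⟨ ∙-congˡ (assoc c b d) ⟩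
    a ∙ (c ∙ (b ∙ d))  ≈⟨ assoc a c _ ⟨
    (a ∙ c) ∙ (b ∙ d)  ∎

  module _ {a} {A : Set a} where

    ∑-cong : ∀ (xs : List A) {φ ψ} → (∀ x → φ x ≈ ψ x) → ∑ xs φ ≈ ∑ xs ψ
    ∑-cong []       e = refl
    ∑-cong (x ∷ xs) e = ∙-cong (e x) (∑-cong xs e)

    ∑-ε : ∀ (xs : List A) → ∑ xs (λ _ → ε) ≈ ε
    ∑-ε []       = refl
    ∑-ε (x ∷ xs) = trans (identityˡ _) (∑-ε xs)

    ∑-∙ : ∀ (xs : List A) φ ψ → ∑ xs (λ x → φ x ∙ ψ x) ≈ ∑ xs φ ∙ ∑ xs ψ
    ∑-∙ []       φ ψ = sym (identityˡ ε)
    ∑-∙ (x ∷ xs) φ ψ = trans (∙-congˡ (∑-∙ xs φ ψ)) (interchange _ _ _ _)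

    ∑-++ : ∀ (xs ys : List A) φ → ∑ (xs ++ ys) φ ≈ ∑ xs φ ∙ ∑ ys φ
    ∑-++ []       ys φ = sym (identityˡ _)
    ∑-++ (x ∷ xs) ys φ = trans (∙-congˡ (∑-++ xs ys φ)) (sym (assoc _ _ _))

    ∑-filter : ∀ {p} {P : A → Set p} (P? : Decidable P) xs φ →
               ∑ (filter P? xs) φ ≈ ∑ xs (λ x → if does (P? x) then φ x else ε)
    ∑-filter P? []       φ = refl
    ∑-filter P? (x ∷ xs) φ with P? x
    ... | true  because _ = ∙-congˡ (∑-filter P? xs φ)
    ... | false because _ = trans (∑-filter P? xs φ) (sym (identityˡ _))

  module _ {a b} {A : Set a} {B : Set b} where

    ∑-map : ∀ (f : A → B) xs φ → ∑ (map f xs) φ ≈ ∑ xs (φ ∘ f)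
    ∑-map f []       φ = refl
    ∑-map f (x ∷ xs) φ = ∙-congˡ (∑-map f xs φ)

    ∑-concatMap : ∀ (f : A → List B) xs φ →
                  ∑ (concatMap f xs) φ ≈ ∑ xs (λ x → ∑ (f x) φ)
    ∑-concatMap f []       φ = refl
    ∑-concatMap f (x ∷ xs) φ =
      trans (∑-++ (f x) _ φ) (∙-congˡ (∑-concatMap f xs φ))

    ∑-swap : ∀ (xs : List A) (ys : List B) (φ : A → B → Carrier) →
             ∑ xs (λ x → ∑ ys (φ x)) ≈ ∑ ys (λ y → ∑ xs (λ x → φ x y))
    ∑-swap []       ys φ = sym (∑-ε ys)
    ∑-swap (x ∷ xs) ys φ =
      trans (∙-congˡ (∑-swap xs ys φ)) (sym (∑-∙ ys (φ x) _))

  ∑-cartesianProductWith :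
    ∀ {a b c} {A : Set a} {B : Set b} {C : Set c} (f : A → B → C) xs ys (φ : C → Carrier) →
    ∑ (cartesianProductWith f xs ys) φ ≈ ∑ xs (λ x → ∑ ys (λ y → φ (f x y)))
  ∑-cartesianProductWith f []       ys φ = refl
  ∑-cartesianProductWith f (x ∷ xs) ys φ =
    trans (∑-++ (map (f x) ys) _ φ)
          (∙-cong (∑-map (f x) ys φ) (∑-cartesianProductWith f xs ys φ))

------------------------------------------------------------------------
-- Modules and algebras over a commutative ring

module LinearAlgebra {c ℓ} (R : CommutativeRing c ℓ) where
  open CommutativeRing R using (ring; 1#; 0#) renaming
    ( Carrier to Scalar; _≈_ to _≈ₛ_; _+_ to _+ₛ_; _*_ to _*ₛ_; -_ to -ₛ_
    ; *-comm to *ₛ-comm; -‿inverseˡ to -ₛ-inverseˡ; -‿inverseʳ to -ₛ-inverseʳ )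

  Mod : ∀ m ℓm → Set (c ⊔ ℓ ⊔ lsuc (m ⊔ ℓm))
  Mod = LeftModule ring

  module _ {m ℓm} (M : Mod m ℓm) where
    open LeftModule M
    open LeftModuleProperties M
    open SetoidReasoning ≈ᴹ-setoid

    -1*x≈-x : ∀ x → (-ₛ 1#) *ₗ x ≈ᴹ -ᴹ x
    -1*x≈-x x = inverseˡ-uniqueᴹ _ x (begin
      (-ₛ 1#) *ₗ x +ᴹ x          ≈⟨ +ᴹ-congˡ (*ₗ-identityˡ x) ⟨
      (-ₛ 1#) *ₗ x +ᴹ 1# *ₗ x    ≈⟨ *ₗ-distribʳ x _ _ ⟨
      ((-ₛ 1#) +ₛ 1#) *ₗ x       ≈⟨ *ₗ-congʳ (-ₛ-inverseˡ 1#) ⟩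
      0# *ₗ x                    ≈⟨ *ₗ-zeroˡ x ⟩
      0ᴹ                         ∎)

    *ₗ-swap : ∀ j k x → j *ₗ k *ₗ x ≈ᴹ k *ₗ j *ₗ x
    *ₗ-swap j k x = begin
      j *ₗ k *ₗ x      ≈⟨ *ₗ-assoc j k x ⟨
      (j *ₛ k) *ₗ x    ≈⟨ *ₗ-congʳ (*ₛ-comm j k) ⟩
      (k *ₛ j) *ₗ x    ≈⟨ *ₗ-assoc k j x ⟩
      k *ₗ j *ₗ x      ∎

    open Summation +ᴹ-commutativeMonoid public using ()
      renaming (∑ to ∑ᴹ; interchange to +ᴹ-interchange)

  ----------------------------------------------------------------------
  -- Linear maps

  infixr 2 _⊸_
  record _⊸_ {m ℓm n ℓn} (M : Mod m ℓm) (N : Mod n ℓn)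
             : Set (c ⊔ m ⊔ ℓm ⊔ n ⊔ ℓn) where
    private
      module M = LeftModule M
      module N = LeftModule N
    open LeftModuleMorphisms M.rawLeftModule N.rawLeftModule
    field
      ⟦_⟧                      : M.Carrierᴹ → N.Carrierᴹ
      isLeftModuleHomomorphism : IsLeftModuleHomomorphism ⟦_⟧
    open IsLeftModuleHomomorphism isLeftModuleHomomorphism public

  open _⊸_ public using (⟦_⟧)

  module _ {m ℓm n ℓn} {M : Mod m ℓm} {N : Mod n ℓn} where
    private
      module M = LeftModule M
      module N = LeftModule N

    infix 4 _≗_
    _≗_ : Rel (M ⊸ N) (m ⊔ ℓn)
    f ≗ g = ∀ x → ⟦ f ⟧ x N.≈ᴹ ⟦ g ⟧ x

    linear : (f : M.Carrierᴹ → N.Carrierᴹ) →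
             (∀ {x y} → x M.≈ᴹ y → f x N.≈ᴹ f y) →
             (∀ x y → f (x M.+ᴹ y) N.≈ᴹ f x N.+ᴹ f y) →
             (∀ k x → f (k M.*ₗ x) N.≈ᴹ k N.*ₗ f x) →
             M ⊸ N
    linear f f-cong f-+ f-* = record
      { ⟦_⟧ = f
      ; isLeftModuleHomomorphism = record
        { +ᴹ-isGroupHomomorphism = record
          { isMonoidHomomorphism = record
            { isMagmaHomomorphism = record
              { isRelHomomorphism = record { cong = f-cong }
              ; homo              = f-+
              }
            ; ε-homo = f-0
            }
          ; ⁻¹-homo = λ x → N.≈ᴹ-trans (f-cong (M.≈ᴹ-sym (-1*x≈-x M x)))
                              (N.≈ᴹ-trans (f-* _ x) (-1*x≈-x N (f x)))
          }
        ; *ₗ-homo = f-*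
        }
      }
      where
      f-0 : f M.0ᴹ N.≈ᴹ N.0ᴹ
      f-0 = N.≈ᴹ-trans (f-cong (M.≈ᴹ-sym (M.*ₗ-zeroˡ M.0ᴹ)))
              (N.≈ᴹ-trans (f-* 0# M.0ᴹ) (N.*ₗ-zeroˡ _))

  idₗ : ∀ {m ℓm} {M : Mod m ℓm} → M ⊸ M
  idₗ {M = M} = linear id id (λ _ _ → ≈ᴹ-refl) (λ _ _ → ≈ᴹ-refl)
    where open LeftModule M

  infixr 9 _∘ₗ_
  _∘ₗ_ : ∀ {l ℓl m ℓm n ℓn} {L : Mod l ℓl} {M : Mod m ℓm} {N : Mod n ℓn} →
         M ⊸ N → L ⊸ M → L ⊸ N
  _∘ₗ_ {N = N} g f = linear (⟦ g ⟧ ∘ ⟦ f ⟧)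
    (G.⟦⟧-cong ∘ F.⟦⟧-cong)
    (λ x y → ≈ᴹ-trans (G.⟦⟧-cong (F.+ᴹ-homo x y)) (G.+ᴹ-homo _ _))
    (λ k x → ≈ᴹ-trans (G.⟦⟧-cong (F.*ₗ-homo k x)) (G.*ₗ-homo k _))
    where
    open LeftModule N
    module F = _⊸_ f
    module G = _⊸_ g

  ----------------------------------------------------------------------
  -- The module with generators G and relations _∼_

  infixl 6 _⊕_
  infixr 7 _⊙_
  data Term {g} (G : Set g) : Set (c ⊔ g) where
    gen : G → Term G
    𝟘   : Term G
    _⊕_ : Term G → Term G → Term G
    _⊙_ : Scalar → Term G → Term G

  module _ {g r} {G : Set g} (_∼_ : Rel (Term G) r) where

    infix 4 _≋_
    data _≋_ : Rel (Term G) (c ⊔ ℓ ⊔ g ⊔ r) where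
      rel         : ∀ {x y} → x ∼ y → x ≋ y
      ≋-refl      : ∀ {x} → x ≋ x
      ≋-sym       : ∀ {x y} → x ≋ y → y ≋ x
      ≋-trans     : ∀ {x y z} → x ≋ y → y ≋ z → x ≋ z
      ⊕-cong      : ∀ {x x′ y y′} → x ≋ x′ → y ≋ y′ → x ⊕ y ≋ x′ ⊕ y′
      ⊕-assoc     : ∀ x y z → (x ⊕ y) ⊕ z ≋ x ⊕ (y ⊕ z)
      ⊕-comm      : ∀ x y → x ⊕ y ≋ y ⊕ x
      ⊕-identityˡ : ∀ x → 𝟘 ⊕ x ≋ x
      ⊙-cong      : ∀ {j k x y} → j ≈ₛ k → x ≋ y → j ⊙ x ≋ k ⊙ y
      ⊙-distribˡ  : ∀ k x y → k ⊙ (x ⊕ y) ≋ k ⊙ x ⊕ k ⊙ y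
      ⊙-distribʳ  : ∀ x j k → (j +ₛ k) ⊙ x ≋ j ⊙ x ⊕ k ⊙ x
      ⊙-assoc     : ∀ j k x → (j *ₛ k) ⊙ x ≋ j ⊙ k ⊙ x
      ⊙-identityˡ : ∀ x → 1# ⊙ x ≋ x
      ⊙-zeroˡ     : ∀ x → 0# ⊙ x ≋ 𝟘
      ⊙-zeroʳ     : ∀ k → k ⊙ 𝟘 ≋ 𝟘

    Presented : Mod (c ⊔ g) (c ⊔ ℓ ⊔ g ⊔ r)
    Presented = record
      { Carrierᴹ = Term G
      ; _≈ᴹ_ = _≋_
      ; _+ᴹ_ = _⊕_
      ; _*ₗ_ = _⊙_
      ; 0ᴹ = 𝟘
      ; -ᴹ_ = (-ₛ 1#) ⊙_
      ; isLeftModule = record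
        { isLeftSemimodule = record
          { +ᴹ-isCommutativeMonoid = record
            { isMonoid = record
              { isSemigroup = record
                { isMagma = record
                  { isEquivalence = record { refl = ≋-refl ; sym = ≋-sym ; trans = ≋-trans }
                  ; ∙-cong = ⊕-cong
                  }
                ; assoc = ⊕-assoc
                }
              ; identity = ⊕-identityˡ , λ x → ≋-trans (⊕-comm x 𝟘) (⊕-identityˡ x)
              }
            ; comm = ⊕-comm
            }
          ; isPreleftSemimodule = record
            { *ₗ-cong = ⊙-cong
            ; *ₗ-zeroˡ = ⊙-zeroˡ
            ; *ₗ-distribʳ = ⊙-distribʳ
            ; *ₗ-identityˡ = ⊙-identityˡ
            ; *ₗ-assoc = ⊙-assoc
            ; *ₗ-zeroʳ = ⊙-zeroʳ
            ; *ₗ-distribˡ = ⊙-distribˡ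
            }
          }
        ; -ᴹ‿cong = ⊙-cong (CommutativeRing.refl R)
        ; -ᴹ‿inverse = inverseˡ , λ x → ≋-trans (⊕-comm x _) (inverseˡ x)
        }
      }
      where
      inverseˡ : ∀ x → (-ₛ 1#) ⊙ x ⊕ x ≋ 𝟘
      inverseˡ x = ≋-trans (⊕-cong ≋-refl (≋-sym (⊙-identityˡ x)))
        (≋-trans (≋-sym (⊙-distribʳ x _ _))
          (≋-trans (⊙-cong (-ₛ-inverseˡ 1#) ≋-refl) (⊙-zeroˡ x)))

  module _ {g n ℓn} {G : Set g} (N : Mod n ℓn) where
    open LeftModule N

    eval : (G → Carrierᴹ) → Term G → Carrierᴹ
    eval f (gen x) = f x
    eval f 𝟘       = 0ᴹ
    eval f (x ⊕ y) = eval f x +ᴹ eval f y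
    eval f (k ⊙ x) = k *ₗ eval f x

    eval-cong : ∀ {f f′} → (∀ g → f g ≈ᴹ f′ g) → ∀ x → eval f x ≈ᴹ eval f′ x
    eval-cong e (gen x) = e x
    eval-cong e 𝟘       = ≈ᴹ-refl
    eval-cong e (x ⊕ y) = +ᴹ-cong (eval-cong e x) (eval-cong e y)
    eval-cong e (k ⊙ x) = *ₗ-congˡ (eval-cong e x)

    eval-0 : ∀ x → eval (λ _ → 0ᴹ) x ≈ᴹ 0ᴹ
    eval-0 (gen x) = ≈ᴹ-refl
    eval-0 𝟘       = ≈ᴹ-refl
    eval-0 (x ⊕ y) = ≈ᴹ-trans (+ᴹ-cong (eval-0 x) (eval-0 y)) (+ᴹ-identityˡ 0ᴹ)
    eval-0 (k ⊙ x) = ≈ᴹ-trans (*ₗ-congˡ (eval-0 x)) (*ₗ-zeroʳ k)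

    eval-+ : ∀ f f′ x → eval (λ g → f g +ᴹ f′ g) x ≈ᴹ eval f x +ᴹ eval f′ x
    eval-+ f f′ (gen x) = ≈ᴹ-refl
    eval-+ f f′ 𝟘       = ≈ᴹ-sym (+ᴹ-identityˡ 0ᴹ)
    eval-+ f f′ (x ⊕ y) = ≈ᴹ-trans (+ᴹ-cong (eval-+ f f′ x) (eval-+ f f′ y))
                                   (+ᴹ-interchange N _ _ _ _)
    eval-+ f f′ (k ⊙ x) = ≈ᴹ-trans (*ₗ-congˡ (eval-+ f f′ x)) (*ₗ-distribˡ k _ _)

    eval-* : ∀ k f x → eval (λ g → k *ₗ f g) x ≈ᴹ k *ₗ eval f x
    eval-* k f (gen x) = ≈ᴹ-refl
    eval-* k f 𝟘       = ≈ᴹ-sym (*ₗ-zeroʳ k)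
    eval-* k f (x ⊕ y) = ≈ᴹ-trans (+ᴹ-cong (eval-* k f x) (eval-* k f y))
                                  (≈ᴹ-sym (*ₗ-distribˡ k _ _))
    eval-* k f (j ⊙ x) = ≈ᴹ-trans (*ₗ-congˡ (eval-* k f x)) (*ₗ-swap N j k _)

  eval-swap : ∀ {g g′ n ℓn} {G : Set g} {G′ : Set g′} (N : Mod n ℓn)
              (h : G → G′ → LeftModule.Carrierᴹ N) x y → LeftModule._≈ᴹ_ N
              (eval N (λ g → eval N (h g) y) x)
              (eval N (λ g′ → eval N (λ g → h g g′) x) y)
  eval-swap N h x (gen y)  = LeftModule.≈ᴹ-refl N
  eval-swap N h x 𝟘        = eval-0 N x
  eval-swap N h x (y ⊕ y′) = LeftModule.≈ᴹ-trans N (eval-+ N _ _ x)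
    (LeftModule.+ᴹ-cong N (eval-swap N h x y) (eval-swap N h x y′))
  eval-swap N h x (k ⊙ y)  = LeftModule.≈ᴹ-trans N (eval-* N k _ x)
    (LeftModule.*ₗ-congˡ N (eval-swap N h x y))

  module _ {g r n ℓn} {G : Set g} {_∼_ : Rel (Term G) r} {N : Mod n ℓn} where
    open LeftModule N

    Respects : (G → Carrierᴹ) → Set (c ⊔ g ⊔ r ⊔ ℓn)
    Respects f = ∀ {x y} → x ∼ y → eval N f x ≈ᴹ eval N f y

    private
      eval-resp : ∀ {f} → Respects f → ∀ {x y} → _≋_ _∼_ x y → eval N f x ≈ᴹ eval N f y
      eval-resp r (rel e)             = r e
      eval-resp r ≋-refl              = ≈ᴹ-refl
      eval-resp r (≋-sym e)           = ≈ᴹ-sym (eval-resp r e)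
      eval-resp r (≋-trans e e′)      = ≈ᴹ-trans (eval-resp r e) (eval-resp r e′)
      eval-resp r (⊕-cong e e′)       = +ᴹ-cong (eval-resp r e) (eval-resp r e′)
      eval-resp r (⊕-assoc x y z)     = +ᴹ-assoc _ _ _
      eval-resp r (⊕-comm x y)        = +ᴹ-comm _ _
      eval-resp r (⊕-identityˡ x)     = +ᴹ-identityˡ _
      eval-resp r (⊙-cong e e′)       = *ₗ-cong e (eval-resp r e′)
      eval-resp r (⊙-distribˡ k x y)  = *ₗ-distribˡ _ _ _
      eval-resp r (⊙-distribʳ x j k)  = *ₗ-distribʳ _ _ _
      eval-resp r (⊙-assoc j k x)     = *ₗ-assoc _ _ _
      eval-resp r (⊙-identityˡ x)     = *ₗ-identityˡ _
      eval-resp r (⊙-zeroˡ x)         = *ₗ-zeroˡ _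
      eval-resp r (⊙-zeroʳ k)         = *ₗ-zeroʳ _

    lift : (f : G → Carrierᴹ) → Respects f → Presented _∼_ ⊸ N
    lift f r = linear (eval N f) (eval-resp r)
                      (λ _ _ → ≈ᴹ-refl) (λ _ _ → ≈ᴹ-refl)

    ⊸-ext : (f f′ : Presented _∼_ ⊸ N) →
            (∀ g → ⟦ f ⟧ (gen g) ≈ᴹ ⟦ f′ ⟧ (gen g)) → f ≗ f′
    ⊸-ext f f′ e (gen x) = e x
    ⊸-ext f f′ e 𝟘       = ≈ᴹ-trans (_⊸_.0ᴹ-homo f) (≈ᴹ-sym (_⊸_.0ᴹ-homo f′))
    ⊸-ext f f′ e (x ⊕ y) = ≈ᴹ-trans (_⊸_.+ᴹ-homo f x y)
      (≈ᴹ-trans (+ᴹ-cong (⊸-ext f f′ e x) (⊸-ext f f′ e y))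
                (≈ᴹ-sym (_⊸_.+ᴹ-homo f′ x y)))
    ⊸-ext f f′ e (k ⊙ x) = ≈ᴹ-trans (_⊸_.*ₗ-homo f k x)
      (≈ᴹ-trans (*ₗ-congˡ (⊸-ext f f′ e x)) (≈ᴹ-sym (_⊸_.*ₗ-homo f′ k x)))

  ----------------------------------------------------------------------
  -- Free modules and tensor products

  data FreeRel {s ℓs} (S : Setoid s ℓs) : Rel (Term (Setoid.Carrier S)) (c ⊔ s ⊔ ℓs) where
    gen-cong : ∀ {x y} → Setoid._≈_ S x y → FreeRel S (gen x) (gen y)

  Free : ∀ {s ℓs} (S : Setoid s ℓs) → Mod (c ⊔ s) (c ⊔ ℓ ⊔ s ⊔ ℓs)
  Free S = Presented (FreeRel S)

  freeLift : ∀ {s ℓs n ℓn} (S : Setoid s ℓs) (N : Mod n ℓn) →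
             (f : Setoid.Carrier S → LeftModule.Carrierᴹ N) →
             (∀ {x y} → Setoid._≈_ S x y → LeftModule._≈ᴹ_ N (f x) (f y)) →
             Free S ⊸ N
  freeLift S N f f-cong = lift f λ { (gen-cong e) → f-cong e }

  module _ {m ℓm n ℓn} (M : Mod m ℓm) (N : Mod n ℓn) where
    private
      module M = LeftModule M
      module N = LeftModule N

    data TensorRel : Rel (Term (M.Carrierᴹ × N.Carrierᴹ)) (c ⊔ m ⊔ ℓm ⊔ n ⊔ ℓn) where
      ⊗-cong     : ∀ {x x′ y y′} → x M.≈ᴹ x′ → y N.≈ᴹ y′ →
                   TensorRel (gen (x , y)) (gen (x′ , y′))
      ⊗-distribʳ : ∀ x x′ y →
                   TensorRel (gen (x M.+ᴹ x′ , y)) (gen (x , y) ⊕ gen (x′ , y))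
      ⊗-distribˡ : ∀ x y y′ →
                   TensorRel (gen (x , y N.+ᴹ y′)) (gen (x , y) ⊕ gen (x , y′))
      ⊗-*ˡ       : ∀ k x y → TensorRel (gen (k M.*ₗ x , y)) (k ⊙ gen (x , y))
      ⊗-*ʳ       : ∀ k x y → TensorRel (gen (x , k N.*ₗ y)) (k ⊙ gen (x , y))

    infixr 5 _⊗_
    _⊗_ : Mod (c ⊔ m ⊔ n) (c ⊔ ℓ ⊔ m ⊔ ℓm ⊔ n ⊔ ℓn)
    _⊗_ = Presented TensorRel

  infixr 5 _⊗ₜ_
  _⊗ₜ_ : ∀ {m n} {M : Set m} {N : Set n} → M → N → Term (M × N)
  x ⊗ₜ y = gen (x , y)

  module _ {m ℓm n ℓn p ℓp} {M : Mod m ℓm} {N : Mod n ℓn} {P : Mod p ℓp} where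
    private
      module M = LeftModule M
      module N = LeftModule N
      module P = LeftModule P

    record IsBilinear (β : M.Carrierᴹ → N.Carrierᴹ → P.Carrierᴹ)
                      : Set (c ⊔ m ⊔ ℓm ⊔ n ⊔ ℓn ⊔ p ⊔ ℓp) where
      field
        cong₂    : ∀ {x x′ y y′} → x M.≈ᴹ x′ → y N.≈ᴹ y′ → β x y P.≈ᴹ β x′ y′
        distribʳ : ∀ x x′ y → β (x M.+ᴹ x′) y P.≈ᴹ β x y P.+ᴹ β x′ y
        distribˡ : ∀ x y y′ → β x (y N.+ᴹ y′) P.≈ᴹ β x y P.+ᴹ β x y′
        homoˡ    : ∀ k x y → β (k M.*ₗ x) y P.≈ᴹ k P.*ₗ β x y
        homoʳ    : ∀ k x y → β x (k N.*ₗ y) P.≈ᴹ k P.*ₗ β x y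

    bilinearLift : ∀ {β} → IsBilinear β → M ⊗ N ⊸ P
    bilinearLift {β} bil = lift (λ (x , y) → β x y) λ
      { (⊗-cong e e′)       → cong₂ e e′
      ; (⊗-distribʳ x x′ y) → distribʳ x x′ y
      ; (⊗-distribˡ x y y′) → distribˡ x y y′
      ; (⊗-*ˡ k x y)        → homoˡ k x y
      ; (⊗-*ʳ k x y)        → homoʳ k x y
      }
      where open IsBilinear bil

    module _ (f : M ⊗ N ⊸ P) where
      open _⊸_ f

      ⊸-isBilinear : IsBilinear (λ x y → ⟦ f ⟧ (x ⊗ₜ y))
      ⊸-isBilinear = record
        { cong₂    = λ e e′ → ⟦⟧-cong (rel (⊗-cong e e′))
        ; distribʳ = λ x x′ y → P.≈ᴹ-trans (⟦⟧-cong (rel (⊗-distribʳ x x′ y))) (+ᴹ-homo _ _)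
        ; distribˡ = λ x y y′ → P.≈ᴹ-trans (⟦⟧-cong (rel (⊗-distribˡ x y y′))) (+ᴹ-homo _ _)
        ; homoˡ    = λ k x y → P.≈ᴹ-trans (⟦⟧-cong (rel (⊗-*ˡ k x y))) (*ₗ-homo _ _)
        ; homoʳ    = λ k x y → P.≈ᴹ-trans (⟦⟧-cong (rel (⊗-*ʳ k x y))) (*ₗ-homo _ _)
        }

    module _ {β} (bil : IsBilinear β) where
      open IsBilinear bil

      fixʳ : N.Carrierᴹ → M ⊸ P
      fixʳ y = linear (λ x → β x y) (λ e → cong₂ e N.≈ᴹ-refl)
                      (λ x x′ → distribʳ x x′ y) (λ k x → homoˡ k x y)

      fixˡ : M.Carrierᴹ → N ⊸ P
      fixˡ x = linear (β x) (cong₂ M.≈ᴹ-refl) (distribˡ x) (λ k y → homoʳ k x y)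

  ⊗-isBilinear : ∀ {m ℓm n ℓn} {M : Mod m ℓm} {N : Mod n ℓn} →
                 IsBilinear {M = M} {N} {M ⊗ N} _⊗ₜ_
  ⊗-isBilinear = ⊸-isBilinear idₗ

  infixr 5 _⊗₁_
  _⊗₁_ : ∀ {m ℓm n ℓn m′ ℓm′ n′ ℓn′} {M : Mod m ℓm} {N : Mod n ℓn}
         {M′ : Mod m′ ℓm′} {N′ : Mod n′ ℓn′} →
         M ⊸ M′ → N ⊸ N′ → M ⊗ N ⊸ M′ ⊗ N′
  _⊗₁_ {M′ = M′} {N′} f g = bilinearLift {β = λ x y → ⟦ f ⟧ x ⊗ₜ ⟦ g ⟧ y} record
    { cong₂    = λ e e′ → cong₂ (F.⟦⟧-cong e) (G.⟦⟧-cong e′)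
    ; distribʳ = λ x x′ y → ≋-trans (cong₂ (F.+ᴹ-homo x x′) N′.≈ᴹ-refl) (distribʳ _ _ _)
    ; distribˡ = λ x y y′ → ≋-trans (cong₂ M′.≈ᴹ-refl (G.+ᴹ-homo y y′)) (distribˡ _ _ _)
    ; homoˡ    = λ k x y → ≋-trans (cong₂ (F.*ₗ-homo k x) N′.≈ᴹ-refl) (homoˡ _ _ _)
    ; homoʳ    = λ k x y → ≋-trans (cong₂ M′.≈ᴹ-refl (G.*ₗ-homo k y)) (homoʳ _ _ _)
    }
    where
    module F = _⊸_ f
    module G = _⊸_ g
    module M′ = LeftModule M′
    module N′ = LeftModule N′
    open IsBilinear (⊗-isBilinear {M = M′} {N′})

  module _ {g r g′ r′ p ℓp} {G : Set g} {_∼_ : Rel (Term G) r}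
           {G′ : Set g′} {_∼′_ : Rel (Term G′) r′} {P : Mod p ℓp}
           (h : G → G′ → LeftModule.Carrierᴹ P)
           (respˡ : ∀ g′ → Respects {_∼_ = _∼_} {P} (λ g → h g g′))
           (respʳ : ∀ g → Respects {_∼_ = _∼′_} {P} (h g))
           where
    private
      module P = LeftModule P

      β : Term G → Term G′ → P.Carrierᴹ
      β x y = eval P (λ g → eval P (h g) y) x

      congʳ : ∀ x {y y′} → _≋_ _∼′_ y y′ → β x y P.≈ᴹ β x y′
      congʳ x e = eval-cong P (λ g → _⊸_.⟦⟧-cong (lift {_∼_ = _∼′_} {P} (h g) (respʳ g)) e) x

      congˡ : ∀ {x x′} y → _≋_ _∼_ x x′ → β x y P.≈ᴹ β x′ y
      congˡ {x} {x′} y e = P.≈ᴹ-trans (eval-swap P h x y) (P.≈ᴹ-trans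
        (eval-cong P (λ g′ → _⊸_.⟦⟧-cong
          (lift {_∼_ = _∼_} {P} (λ g → h g g′) (respˡ g′)) e) y)
        (P.≈ᴹ-sym (eval-swap P h x′ y)))

    eval₂-isBilinear : IsBilinear {M = Presented _∼_} {Presented _∼′_} {P} β
    eval₂-isBilinear = record
      { cong₂    = λ {x} {x′} {y} e e′ → P.≈ᴹ-trans (congˡ y e) (congʳ x′ e′)
      ; distribʳ = λ x x′ y → P.≈ᴹ-refl
      ; distribˡ = λ x y y′ → eval-+ P _ _ x
      ; homoˡ    = λ k x y → P.≈ᴹ-refl
      ; homoʳ    = λ k x y → eval-* P k _ x
      }

  -- For f : A ⊗ A′ ⊸ C and g : B ⊗ B′ ⊸ D, the map
  -- (a ⊗ b) ⊗ (a′ ⊗ b′) ↦ f (a ⊗ a′) ⊗ g (b ⊗ b′).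
  module _ {a ℓa a′ ℓa′ b ℓb b′ ℓb′ c′ ℓc d ℓd}
           {A : Mod a ℓa} {A′ : Mod a′ ℓa′} {B : Mod b ℓb} {B′ : Mod b′ ℓb′}
           {C : Mod c′ ℓc} {D : Mod d ℓd} where
    private
      module A = LeftModule A
      module A′ = LeftModule A′
      module B = LeftModule B
      module B′ = LeftModule B′
      module C = LeftModule C
      module D = LeftModule D
      open IsBilinear (⊗-isBilinear {M = C} {D})

    interchange : A ⊗ A′ ⊸ C → B ⊗ B′ ⊸ D → (A ⊗ B) ⊗ (A′ ⊗ B′) ⊸ C ⊗ D
    interchange f g = bilinearLift (eval₂-isBilinear
      (λ (x , y) (x′ , y′) → ⟦ f ⟧ (x ⊗ₜ x′) ⊗ₜ ⟦ g ⟧ (y ⊗ₜ y′))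
      (λ (x′ , y′) → λ
        { (⊗-cong e e′)       → cong₂ (F.cong₂ e A′.≈ᴹ-refl) (G.cong₂ e′ B′.≈ᴹ-refl)
        ; (⊗-distribʳ x z y)  → ≋-trans (cong₂ (F.distribʳ x z x′) D.≈ᴹ-refl) (distribʳ _ _ _)
        ; (⊗-distribˡ x y z)  → ≋-trans (cong₂ C.≈ᴹ-refl (G.distribʳ y z y′)) (distribˡ _ _ _)
        ; (⊗-*ˡ k x y)        → ≋-trans (cong₂ (F.homoˡ k x x′) D.≈ᴹ-refl) (homoˡ _ _ _)
        ; (⊗-*ʳ k x y)        → ≋-trans (cong₂ C.≈ᴹ-refl (G.homoˡ k y y′)) (homoʳ _ _ _)
        })
      (λ (x , y) → λ
        { (⊗-cong e e′)         → cong₂ (F.cong₂ A.≈ᴹ-refl e) (G.cong₂ B.≈ᴹ-refl e′)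
        ; (⊗-distribʳ x′ z y′)  → ≋-trans (cong₂ (F.distribˡ x x′ z) D.≈ᴹ-refl) (distribʳ _ _ _)
        ; (⊗-distribˡ x′ y′ z)  → ≋-trans (cong₂ C.≈ᴹ-refl (G.distribˡ y y′ z)) (distribˡ _ _ _)
        ; (⊗-*ˡ k x′ y′)        → ≋-trans (cong₂ (F.homoʳ k x x′) D.≈ᴹ-refl) (homoˡ _ _ _)
        ; (⊗-*ʳ k x′ y′)        → ≋-trans (cong₂ C.≈ᴹ-refl (G.homoʳ k y y′)) (homoʳ _ _ _)
        }))
      where
      module F = IsBilinear (⊸-isBilinear f)
      module G = IsBilinear (⊸-isBilinear g)

  ----------------------------------------------------------------------
  -- Commutative algebras

  record CommutativeAlgebra a ℓa : Set (c ⊔ ℓ ⊔ lsuc (a ⊔ ℓa)) where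
    infixl 7 _*_
    field
      mod : Mod a ℓa
    open LeftModule mod public
    field
      μ  : mod ⊗ mod ⊸ mod
      1ᴬ : Carrierᴹ

    _*_ : Carrierᴹ → Carrierᴹ → Carrierᴹ
    x * y = ⟦ μ ⟧ (x ⊗ₜ y)

    field
      *-isCommutativeMonoid : IsCommutativeMonoid _≈ᴹ_ _*_ 1ᴬ

    *-commutativeMonoid : CommutativeMonoid a ℓa
    *-commutativeMonoid = record { isCommutativeMonoid = *-isCommutativeMonoid }

    open IsCommutativeMonoid *-isCommutativeMonoid public using () renaming
      (assoc to *-assoc; comm to *-comm; identityˡ to *-identityˡ
      ; identityʳ to *-identityʳ; ∙-cong to *-cong)

    *-isBilinear : IsBilinear _*_
    *-isBilinear = ⊸-isBilinear μ

    *- -* : Carrierᴹ → mod ⊸ mod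
    *- = fixˡ *-isBilinear
    -* = fixʳ *-isBilinear

  open CommutativeAlgebra public using (mod)

  record AlgebraHom {a ℓa b ℓb} (A : CommutativeAlgebra a ℓa)
                    (B : CommutativeAlgebra b ℓb) : Set (c ⊔ a ⊔ ℓa ⊔ b ⊔ ℓb) where
    private
      module A = CommutativeAlgebra A
      module B = CommutativeAlgebra B
    field
      linearMap : mod A ⊸ mod B
      *-homo    : ∀ x y → ⟦ linearMap ⟧ (x A.* y) B.≈ᴹ ⟦ linearMap ⟧ x B.* ⟦ linearMap ⟧ y
      1-homo    : ⟦ linearMap ⟧ A.1ᴬ B.≈ᴹ B.1ᴬ

  -- A presented module with a commutative multiplication is a commutative
  -- algebra as soon as the laws hold on generators.
  module _ {g r} {G : Set g} {_∼_ : Rel (Term G) r}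
           (μ : Presented _∼_ ⊗ Presented _∼_ ⊸ Presented _∼_) (1ᴬ : Term G) where
    private
      infixl 7 _*_
      infix 4 _≈_
      _*_ : Term G → Term G → Term G
      x * y = ⟦ μ ⟧ (x ⊗ₜ y)
      _≈_ = _≋_ _∼_
      bil = ⊸-isBilinear μ
      module μ = IsBilinear bil
      *- = fixˡ bil
      -* = fixʳ bil

    commutativeAlgebra :
      (∀ x y z → (gen x * gen y) * gen z ≈ gen x * (gen y * gen z)) →
      (∀ x y → gen x * gen y ≈ gen y * gen x) →
      (∀ x → 1ᴬ * gen x ≈ gen x) →
      CommutativeAlgebra (c ⊔ g) (c ⊔ ℓ ⊔ g ⊔ r)
    commutativeAlgebra assoc-gen comm-gen identity-gen = record
      { mod = Presented _∼_
      ; μ = μ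
      ; 1ᴬ = 1ᴬ
      ; *-isCommutativeMonoid = record
        { isMonoid = record
          { isSemigroup = record
            { isMagma = record
              { isEquivalence = LeftModule.≈ᴹ-isEquivalence (Presented _∼_)
              ; ∙-cong = μ.cong₂
              }
            ; assoc = assoc
            }
          ; identity = identityˡ , λ x → ≋-trans (comm x 1ᴬ) (identityˡ x)
          }
        ; comm = comm
        }
      }
      where
      assoc : ∀ x y z → (x * y) * z ≈ x * (y * z)
      assoc x y z =
        ⊸-ext (-* z ∘ₗ -* y) (-* (y * z))
          (λ g → ⊸-ext (-* z ∘ₗ *- (gen g)) (*- (gen g) ∘ₗ -* z)
            (λ g′ → ⊸-ext (*- (gen g * gen g′)) (*- (gen g) ∘ₗ *- (gen g′))
              (assoc-gen g g′) z) y) x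

      comm : ∀ x y → x * y ≈ y * x
      comm x y = ⊸-ext (-* y) (*- y)
        (λ g → ⊸-ext (*- (gen g)) (-* (gen g)) (comm-gen g) y) x

      identityˡ : ∀ x → 1ᴬ * x ≈ x
      identityˡ = ⊸-ext (*- 1ᴬ) idₗ identity-gen

  infixr 5 _⊗ᴬ_
  _⊗ᴬ_ : ∀ {a ℓa b ℓb} → CommutativeAlgebra a ℓa → CommutativeAlgebra b ℓb →
         CommutativeAlgebra (c ⊔ a ⊔ b) (c ⊔ ℓ ⊔ a ⊔ ℓa ⊔ b ⊔ ℓb)
  A ⊗ᴬ B = commutativeAlgebra (interchange A.μ B.μ) (A.1ᴬ ⊗ₜ B.1ᴬ)
    (λ (x , x′) (y , y′) (z , z′) → rel (⊗-cong (A.*-assoc x y z) (B.*-assoc x′ y′ z′)))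
    (λ (x , x′) (y , y′) → rel (⊗-cong (A.*-comm x y) (B.*-comm x′ y′)))
    (λ (x , x′) → rel (⊗-cong (A.*-identityˡ x) (B.*-identityˡ x′)))
    where
    module A = CommutativeAlgebra A
    module B = CommutativeAlgebra B

  -- The free commutative algebra on S: the free module on the monomials in S,
  -- a monomial being a list of elements of S up to permutation.
  module _ {s ℓs} (S : Setoid s ℓs) where
    open PermutationSetoid S using (↭-setoid)
    open PermutationProperties S using (++-assoc; ++-comm; ++⁺; ++⁺ˡ; ++⁺ʳ)

    Monomial : Setoid s (s ⊔ ℓs)
    Monomial = ↭-setoid

    FreeAlgebra : CommutativeAlgebra (c ⊔ s) (c ⊔ ℓ ⊔ s ⊔ ℓs)
    FreeAlgebra = commutativeAlgebra {_∼_ = FreeRel Monomial}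
      (bilinearLift (eval₂-isBilinear
        (λ u v → gen (u ++ v))
        (λ v → λ { (gen-cong e) → rel (gen-cong (++⁺ʳ v e)) })
        (λ u → λ { (gen-cong e) → rel (gen-cong (++⁺ˡ u e)) })))
      (gen [])
      (λ u v w → rel (gen-cong (++-assoc u v w)))
      (λ u v → rel (gen-cong (++-comm u v)))
      (λ u → ≋-refl)

  module _ {s ℓs a ℓa} (S : Setoid s ℓs) (A : CommutativeAlgebra a ℓa)
           (f : Setoid.Carrier S → CommutativeAlgebra.Carrierᴹ A)
           (f-cong : ∀ {x y} → Setoid._≈_ S x y → CommutativeAlgebra._≈ᴹ_ A (f x) (f y))
           where
    private
      module A = CommutativeAlgebra A
      module F = CommutativeAlgebra (FreeAlgebra S)

      ∏ : List (Setoid.Carrier S) → A.Carrierᴹ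
      ∏ u = foldr A._*_ A.1ᴬ (map f u)

      ∏-cong : ∀ {u v} → PermutationSetoid._↭_ S u v → ∏ u A.≈ᴹ ∏ v
      ∏-cong e = foldr-commMonoid A.*-isCommutativeMonoid (map⁺ A.≈ᴹ-setoid f-cong e)
        where
        open PermutationProperties S using (map⁺)
        open PermutationProperties A.≈ᴹ-setoid using (foldr-commMonoid)

      ∏-++ : ∀ u v → ∏ (u ++ v) A.≈ᴹ ∏ u A.* ∏ v
      ∏-++ []      v = A.≈ᴹ-sym (A.*-identityˡ _)
      ∏-++ (x ∷ u) v = A.≈ᴹ-trans (A.*-cong A.≈ᴹ-refl (∏-++ u v))
                                  (A.≈ᴹ-sym (A.*-assoc _ _ _))

    algebraLift : AlgebraHom (FreeAlgebra S) A
    algebraLift = record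
      { linearMap = L
      ; *-homo = λ x y →
          ⊸-ext (L ∘ₗ F.-* y) (A.-* (⟦ L ⟧ y) ∘ₗ L)
            (λ u → ⊸-ext (L ∘ₗ F.*- (gen u)) (A.*- (∏ u) ∘ₗ L) (∏-++ u) y) x
      ; 1-homo = A.≈ᴹ-refl
      }
      where
      L : F.mod ⊸ A.mod
      L = freeLift (Monomial S) A.mod ∏ ∏-cong

------------------------------------------------------------------------
-- Rooted trees

data Tree (A : Set) : Set where
  node : A → List (Tree A) → Tree A

Forest : Set → Set
Forest A = List (Tree A)

-- Isomorphism of rooted trees whose vertices are labelled in A: the branches
-- at a vertex may be permuted.
infix 4 _≅_
data _≅_ {A : Set} : Rel (Tree A) 0ℓ where
  node : ∀ {a ts us} → Permutation _≅_ ts us → node a ts ≅ node a us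

module _ {A : Set} where
  open Homogeneous using (refl; prep; swap; trans)

  mutual
    ≅-refl : ∀ (t : Tree A) → t ≅ t
    ≅-refl (node a ts) = node (refl (≅-refls ts))

    ≅-refls : ∀ (ts : Forest A) → Pointwise _≅_ ts ts
    ≅-refls []       = []
    ≅-refls (t ∷ ts) = ≅-refl t ∷ ≅-refls ts

  mutual
    ≅-sym : ∀ {t u : Tree A} → t ≅ u → u ≅ t
    ≅-sym (node p) = node (≅-symᵖ p)

    ≅-symᵖ : ∀ {ts us : Forest A} → Permutation _≅_ ts us → Permutation _≅_ us ts
    ≅-symᵖ (refl es)     = refl (≅-syms es)
    ≅-symᵖ (prep e p)    = prep (≅-sym e) (≅-symᵖ p)
    ≅-symᵖ (swap e e′ p) = swap (≅-sym e′) (≅-sym e) (≅-symᵖ p)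
    ≅-symᵖ (trans p q)   = trans (≅-symᵖ q) (≅-symᵖ p)

    ≅-syms : ∀ {ts us : Forest A} → Pointwise _≅_ ts us → Pointwise _≅_ us ts
    ≅-syms []       = []
    ≅-syms (e ∷ es) = ≅-sym e ∷ ≅-syms es

  ≅-trans : ∀ {t u v : Tree A} → t ≅ u → u ≅ v → t ≅ v
  ≅-trans (node p) (node q) = node (trans p q)

treeSetoid : Set → Setoid 0ℓ 0ℓ
treeSetoid A = record
  { Carrier       = Tree A
  ; _≈_           = _≅_
  ; isEquivalence = record { refl = ≅-refl _ ; sym = ≅-sym ; trans = ≅-trans }
  }

RootedTree RootedForest : Set
RootedTree   = Tree ⊤
RootedForest = Forest ⊤

data HasEdge : RootedTree → Set where
  hasEdge : ∀ {t ts} → HasEdge (node tt (t ∷ ts))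

EdgeTree : Set
EdgeTree = Σ RootedTree HasEdge

edgeTreeSetoid : Setoid 0ℓ 0ℓ
edgeTreeSetoid = On.setoid {B = EdgeTree} (treeSetoid ⊤) proj₁

------------------------------------------------------------------------
-- Subforests of a rooted tree and their contraction

-- A subtree of node tt ts containing the root: for each branch, either the
-- subtree stops at the root, or it contains the edge leading to that branch
-- and continues as a subtree of the branch containing its root.
data Growth : RootedForest → Set where
  []   : Growth []
  skip : ∀ {t f} → Growth f → Growth (t ∷ f)
  grow : ∀ {ts f} → Growth ts → Growth f → Growth (node tt ts ∷ f)

-- A set of pairwise vertex-disjoint subtrees with at least one edge: either
-- some member g contains the root, or none does, in which case g is the
-- subtree reduced to the root, which does not count as a member. The other
-- members avoid g, hence lie in the trees which remain when the vertices of g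
-- are removed; Avoiding g consists of a subforest of each of these trees.
mutual
  data Subforest : RootedTree → Set where
    node : ∀ {ts} (g : Growth ts) → Avoiding g → Subforest (node tt ts)

  data Avoiding : ∀ {f} → Growth f → Set where
    []   : Avoiding []
    skip : ∀ {t f} {g : Growth f} → Subforest t → Avoiding g → Avoiding (skip {t} g)
    grow : ∀ {ts f} {g : Growth ts} {h : Growth f} →
           Avoiding g → Avoiding h → Avoiding (grow g h)

growths : ∀ f → List (Growth f)
growths []               = [ [] ]
growths (node tt ts ∷ f) =
  map skip (growths f) ++ cartesianProductWith grow (growths ts) (growths f)

mutual
  subforests : ∀ t → List (Subforest t)
  subforests (node tt ts) = concatMap (λ g → map (node g) (avoiding ts g)) (growths ts)

  avoiding : ∀ f (g : Growth f) → List (Avoiding g)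
  avoiding []               []         = [ [] ]
  avoiding (t ∷ f)          (skip g)   =
    cartesianProductWith skip (subforests t) (avoiding f g)
  avoiding (node tt ts ∷ f) (grow g h) =
    cartesianProductWith grow (avoiding ts g) (avoiding f h)

branches : ∀ {f} → Growth f → RootedForest
branches []         = []
branches (skip g)   = branches g
branches (grow g h) = node tt (branches g) ∷ branches h

rootComponent : RootedForest → List EdgeTree
rootComponent []       = []
rootComponent (t ∷ ts) = [ node tt (t ∷ ts) , hasEdge ]

mutual
  components : ∀ {t} → Subforest t → List EdgeTree
  components (node g a) = rootComponent (branches g) ++ componentsᵃ a

  componentsᵃ : ∀ {f} {g : Growth f} → Avoiding g → List EdgeTree
  componentsᵃ []         = []
  componentsᵃ (skip s a) = components s ++ componentsᵃ a
  componentsᵃ (grow a b) = componentsᵃ a ++ componentsᵃ b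

-- The tree t/s. Once g is contracted to the root, the branches at the root
-- are the contracted trees which were attached to the vertices of g.
mutual
  contract : ∀ {t} → Subforest t → RootedTree
  contract (node g a) = node tt (contractᵃ a)

  contractᵃ : ∀ {f} {g : Growth f} → Avoiding g → RootedForest
  contractᵃ []         = []
  contractᵃ (skip s a) = contract s ∷ contractᵃ a
  contractᵃ (grow a b) = contractᵃ a ++ contractᵃ b

------------------------------------------------------------------------
-- Ordered decompositions of the vertex set of a rooted forest

data Vertex {A : Set} : Forest A → Set where
  root  : ∀ {a ts f} → Vertex (node a ts ∷ f)
  above : ∀ {a ts f} → Vertex ts → Vertex (node a ts ∷ f)
  next  : ∀ {t f} → Vertex f → Vertex (t ∷ f)

-- x ≺ y iff x ≢ y and the path from a root to y passes through x.
infix 4 _≺_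
data _≺_ {A : Set} : ∀ {f : Forest A} → Rel (Vertex f) 0ℓ where
  root  : ∀ {a ts f} {y : Vertex ts} → root {a = a} {ts} {f} ≺ above y
  above : ∀ {a ts f} {x y : Vertex ts} → x ≺ y → above {a = a} {ts} {f} x ≺ above y
  next  : ∀ {t f} {x y : Vertex f} → x ≺ y → next {t = t} x ≺ next y

label : ∀ {A} {f : Forest A} → Vertex f → A
label (root {a = a}) = a
label (above x)      = label x
label (next x)       = label x

data Part : Set where
  V W : Part

infix 4 _≟_
_≟_ : DecidableEquality Part
V ≟ V = yes ≡.refl
V ≟ W = no λ ()
W ≟ V = no λ ()
W ≟ W = yes ≡.refl

-- A map from the vertices of a forest u to {V, W} is given as a forest with
-- labels in Part whose underlying forest is u.
mutual
  labellings : RootedTree → List (Tree Part)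
  labellings (node tt ts) = cartesianProductWith node (V ∷ W ∷ []) (labellingsᶠ ts)

  labellingsᶠ : RootedForest → List (Forest Part)
  labellingsᶠ []      = [ [] ]
  labellingsᶠ (t ∷ f) = cartesianProductWith _∷_ (labellings t) (labellingsᶠ f)

Admissible : Forest Part → Set
Admissible u = ∀ (x y : Vertex u) → x ≺ y → ¬ (label x ≡ V × label y ≡ W)

allLabels? : ∀ {A : Set} {P : A → Set} → Decidable P →
             ∀ f → Dec (∀ (x : Vertex f) → P (label x))
allLabels? P? []              = yes λ ()
allLabels? P? (node a ts ∷ f) = map′
  (λ (p , q , r) → λ { root → p ; (above x) → q x ; (next x) → r x })
  (λ p → p root , (λ x → p (above x)) , (λ x → p (next x)))
  (P? a ×-dec allLabels? P? ts ×-dec allLabels? P? f)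

admissible? : Decidable Admissible
admissible? []              = yes λ ()
admissible? (node a ts ∷ f) = map′
  (λ (p , q , r) → λ { _ _ (root {y = y}) → p y ; _ _ (above e) → q _ _ e ; _ _ (next e) → r _ _ e })
  (λ p → (λ y → p _ _ (root {y = y})) , (λ _ _ e → p _ _ (above e)) , (λ _ _ e → p _ _ (next e)))
  (allLabels? (λ b → ¬? ((a ≟ V) ×-dec (b ≟ W))) ts
    ×-dec admissible? ts ×-dec admissible? f)

decompositions : RootedForest → List (Forest Part)
decompositions u = filter admissible? (labellingsᶠ u)

-- The forest induced on the vertices labelled p. Of its trees, atRoots p u
-- consists of those whose root is a root of u.
mutual
  induced : Part → Forest Part → RootedForest
  induced p u = atRoots p u ++ offRoots p u

  atRoots offRoots : Part → Forest Part → RootedForest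
  atRoots p []       = []
  atRoots p (t ∷ u)  = atRootᵗ p t ++ atRoots p u
  offRoots p []      = []
  offRoots p (t ∷ u) = offRootᵗ p t ++ offRoots p u

  atRootᵗ offRootᵗ : Part → Tree Part → RootedForest
  atRootᵗ p (node q ts)  = if does (p ≟ q) then [ node tt (atRoots p ts) ] else []
  offRootᵗ p (node q ts) = if does (p ≟ q) then offRoots p ts else induced p ts

------------------------------------------------------------------------
-- The sums over subforests and over ordered decompositions depend only on the
-- isomorphism class

infix 4 _≅ᶠ_ _↭ᴱ_ _≅³_

_≅ᶠ_ : ∀ {A} → Rel (Forest A) 0ℓ
_≅ᶠ_ {A} = PermutationSetoid._↭_ (treeSetoid A)

_↭ᴱ_ : Rel (List EdgeTree) 0ℓ
_↭ᴱ_ = PermutationSetoid._↭_ edgeTreeSetoid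

module ≅ᶠ {A} = PermutationProperties (treeSetoid A)
module ≅ᶠ-Setoid {A} = Setoid (PermutationSetoid.↭-setoid (treeSetoid A))
module ↭ᴱ = PermutationProperties edgeTreeSetoid
module ↭ᴱ-Setoid = Setoid (PermutationSetoid.↭-setoid edgeTreeSetoid)

Triple : Set
Triple = RootedForest × List EdgeTree × RootedForest

_≅³_ : Rel Triple 0ℓ
(x , y , z) ≅³ (x′ , y′ , z′) = x ≅ᶠ x′ × y ↭ᴱ y′ × z ≅ᶠ z′

infixr 5 _⊞_
_⊞_ : Triple → Triple → Triple
(x , y , z) ⊞ (x′ , y′ , z′) = x ++ x′ , y ++ y′ , z ++ z′

≅³-refl : ∀ {p} → p ≅³ p
≅³-refl = ≅ᶠ-Setoid.refl , ↭ᴱ-Setoid.refl , ≅ᶠ-Setoid.refl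

⊞-cong : ∀ {p p′ q q′} → p ≅³ p′ → q ≅³ q′ → p ⊞ q ≅³ p′ ⊞ q′
⊞-cong (a , b , c) (a′ , b′ , c′) = ≅ᶠ.++⁺ a a′ , ↭ᴱ.++⁺ b b′ , ≅ᶠ.++⁺ c c′

⊞-swap : ∀ p q r → p ⊞ q ⊞ r ≅³ q ⊞ p ⊞ r
⊞-swap (x , y , z) (x′ , y′ , z′) _ =
  ≅ᶠ.shifts x x′ , ↭ᴱ.shifts y y′ , ≅ᶠ.shifts z z′

rootComponent-cong : ∀ {f f′} → f ≅ᶠ f′ → rootComponent f ↭ᴱ rootComponent f′
rootComponent-cong {[]}    {[]}     p = ↭ᴱ-Setoid.refl
rootComponent-cong {_ ∷ _} {_ ∷ _}  p = Homogeneous.prep (node p) ↭ᴱ-Setoid.refl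
rootComponent-cong {[]}    {_ ∷ _}  p = contradiction (≅ᶠ-Setoid.sym p) ≅ᶠ.¬x∷xs↭[]
rootComponent-cong {_ ∷ _} {[]}     p = contradiction p ≅ᶠ.¬x∷xs↭[]

outcome : ∀ {f} {g : Growth f} → Avoiding g → Triple
outcome {g = g} a = branches g , componentsᵃ a , contractᵃ a

outcomes : RootedForest → List Triple
outcomes f = concatMap (λ g → map outcome (avoiding f g)) (growths f)

-- The contribution of a tree t to the outcomes of a forest t ∷ f, according
-- to whether the edge leading to t is cut or kept.
cut keep : Triple → Triple
cut  (x , y , z) = [] , rootComponent x ++ y , [ node tt z ]
keep (x , y , z) = [ node tt x ] , y , z

cut-cong : ∀ {p p′} → p ≅³ p′ → cut p ≅³ cut p′
cut-cong (a , b , c) =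
  ≅ᶠ-Setoid.refl , ↭ᴱ.++⁺ (rootComponent-cong a) b , Homogeneous.prep (node c) ≅ᶠ-Setoid.refl

keep-cong : ∀ {p p′} → p ≅³ p′ → keep p ≅³ keep p′
keep-cong (a , b , c) = Homogeneous.prep (node a) ≅ᶠ-Setoid.refl , b , c

contributions : RootedTree → List Triple
contributions (node tt ts) = map cut (outcomes ts) ++ map keep (outcomes ts)

module SubforestSums {m ℓm} (M : CommutativeMonoid m ℓm) where
  open CommutativeMonoid M
  open Summation M
  open SetoidReasoning setoid

  ∑-outcomes : ∀ f φ → ∑ (outcomes f) φ ≈
               ∑ (growths f) (λ g → ∑ (avoiding f g) (λ a → φ (outcome a)))
  ∑-outcomes f φ = trans (∑-concatMap _ (growths f) φ)
    (∑-cong (growths f) (λ g → ∑-map outcome (avoiding f g) φ))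

  ∑-subforests : ∀ ts (ψ : List EdgeTree → RootedTree → Carrier) →
    ∑ (subforests (node tt ts)) (λ s → ψ (components s) (contract s)) ≈
    ∑ (outcomes ts) (λ (x , y , z) → ψ (rootComponent x ++ y) (node tt z))
  ∑-subforests ts ψ = begin
    ∑ (subforests (node tt ts)) (λ s → ψ (components s) (contract s))
      ≈⟨ ∑-concatMap _ (growths ts) _ ⟩
    ∑ (growths ts) (λ g → ∑ (map (node g) (avoiding ts g)) _)
      ≈⟨ ∑-cong (growths ts) (λ g → ∑-map (node g) (avoiding ts g) _) ⟩
    ∑ (growths ts) (λ g → ∑ (avoiding ts g) (λ a →
      ψ (rootComponent (branches g) ++ componentsᵃ a) (node tt (contractᵃ a))))
      ≈⟨ ∑-outcomes ts _ ⟨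
    ∑ (outcomes ts) (λ (x , y , z) → ψ (rootComponent x ++ y) (node tt z)) ∎

  ∑-outcomes-∷ : ∀ t f φ → ∑ (outcomes (t ∷ f)) φ ≈
    ∑ (contributions t) (λ p → ∑ (outcomes f) (λ q → φ (p ⊞ q)))
  ∑-outcomes-∷ t@(node tt ts) f φ = begin
    ∑ (outcomes (t ∷ f)) φ
      ≈⟨ ∑-outcomes (t ∷ f) φ ⟩
    ∑ (map skip F ++ cartesianProductWith grow T F) φᵍ
      ≈⟨ ∑-++ (map skip F) _ φᵍ ⟩
    ∑ (map skip F) φᵍ ∙ ∑ (cartesianProductWith grow T F) φᵍ
      ≈⟨ ∙-cong cutting keeping ⟩
    ∑ (map cut (outcomes ts)) ψ ∙ ∑ (map keep (outcomes ts)) ψ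
      ≈⟨ ∑-++ (map cut (outcomes ts)) _ ψ ⟨
    ∑ (contributions t) ψ ∎
    where
    F = growths f
    T = growths ts
    φᵍ : Growth (t ∷ f) → Carrier
    φᵍ g = ∑ (avoiding (t ∷ f) g) (λ a → φ (outcome a))
    ψ : Triple → Carrier
    ψ p = ∑ (outcomes f) (λ q → φ (p ⊞ q))

    cutting : ∑ (map skip F) φᵍ ≈ ∑ (map cut (outcomes ts)) ψ
    cutting = begin
      ∑ (map skip F) φᵍ
        ≈⟨ ∑-map skip F φᵍ ⟩
      ∑ F (λ g → φᵍ (skip g))
        ≈⟨ ∑-cong F (λ g → ∑-cartesianProductWith skip (subforests t) (avoiding f g) _) ⟩
      ∑ F (λ g → ∑ (subforests t) (λ s → ∑ (avoiding f g) (λ a → φ (outcome (skip s a)))))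
        ≈⟨ ∑-swap F (subforests t) _ ⟩
      ∑ (subforests t) (λ s → ∑ F (λ g → ∑ (avoiding f g) (λ a → φ (outcome (skip s a)))))
        ≈⟨ ∑-cong (subforests t) (λ s → ∑-outcomes f
             (λ q → φ (([] , components s , [ contract s ]) ⊞ q))) ⟨
      ∑ (subforests t) (λ s → ψ ([] , components s , [ contract s ]))
        ≈⟨ ∑-subforests ts (λ y z → ψ ([] , y , [ z ])) ⟩
      ∑ (outcomes ts) (λ p → ψ (cut p))
        ≈⟨ ∑-map cut (outcomes ts) ψ ⟨
      ∑ (map cut (outcomes ts)) ψ ∎

    keeping : ∑ (cartesianProductWith grow T F) φᵍ ≈ ∑ (map keep (outcomes ts)) ψ
    keeping = begin
      ∑ (cartesianProductWith grow T F) φᵍ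
        ≈⟨ ∑-cartesianProductWith grow T F φᵍ ⟩
      ∑ T (λ g → ∑ F (λ h → φᵍ (grow g h)))
        ≈⟨ ∑-cong T (λ g → ∑-cong F (λ h →
             ∑-cartesianProductWith grow (avoiding ts g) (avoiding f h) _)) ⟩
      ∑ T (λ g → ∑ F (λ h → ∑ (avoiding ts g) (λ a → ∑ (avoiding f h) (λ b →
        φ (outcome (grow a b))))))
        ≈⟨ ∑-cong T (λ g → ∑-swap F (avoiding ts g) _) ⟩
      ∑ T (λ g → ∑ (avoiding ts g) (λ a → ∑ F (λ h → ∑ (avoiding f h) (λ b →
        φ (outcome (grow a b))))))
        ≈⟨ ∑-cong T (λ g → ∑-cong (avoiding ts g) (λ a →
             ∑-outcomes f (λ q → φ (keep (outcome a) ⊞ q)))) ⟨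
      ∑ T (λ g → ∑ (avoiding ts g) (λ a → ψ (keep (outcome a))))
        ≈⟨ ∑-outcomes ts (λ p → ψ (keep p)) ⟨
      ∑ (outcomes ts) (λ p → ψ (keep p))
        ≈⟨ ∑-map keep (outcomes ts) ψ ⟨
      ∑ (map keep (outcomes ts)) ψ ∎

  _≈³_ : Rel (Triple → Carrier) ℓm
  φ ≈³ φ′ = ∀ {p p′} → p ≅³ p′ → φ p ≈ φ′ p′

  open Homogeneous using (prep; swap)

  mutual
    ∑-outcomes-cong : ∀ {f f′} → f ≅ᶠ f′ → ∀ {φ φ′} → φ ≈³ φ′ →
                      ∑ (outcomes f) φ ≈ ∑ (outcomes f′) φ′
    ∑-outcomes-cong (Homogeneous.refl es) e = ∑-outcomes-congᵖ es e
    ∑-outcomes-cong (prep {xs} {ys} {t} {u} t≅u p) e = ∑-outcomes-cong-∷ t≅u p e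
    ∑-outcomes-cong (swap {xs} {ys} {t} {u} {t′} {u′} t≅t′ u≅u′ p) {φ} {φ′} e = begin
      ∑ (outcomes (t ∷ u ∷ xs)) φ
        ≈⟨ expand t u xs φ ⟩
      ∑ (contributions t) (λ p → ∑ (contributions u) (λ q →
        ∑ (outcomes xs) (λ r → φ (p ⊞ q ⊞ r))))
        ≈⟨ ∑-contributions-cong t≅t′ (λ {p₁} e₁ → ∑-contributions-cong u≅u′ (λ {p₂} e₂ →
             ∑-outcomes-cong p (λ {r} e₃ → e (≅³-trans (⊞-swap p₁ p₂ r) (⊞-cong e₂ (⊞-cong e₁ e₃)))))) ⟩
      ∑ (contributions t′) (λ p → ∑ (contributions u′) (λ q →
        ∑ (outcomes ys) (λ r → φ′ (q ⊞ p ⊞ r))))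
        ≈⟨ ∑-swap (contributions t′) (contributions u′) _ ⟩
      ∑ (contributions u′) (λ q → ∑ (contributions t′) (λ p →
        ∑ (outcomes ys) (λ r → φ′ (q ⊞ p ⊞ r))))
        ≈⟨ expand u′ t′ ys φ′ ⟨
      ∑ (outcomes (u′ ∷ t′ ∷ ys)) φ′ ∎
      where
      ≅³-trans : ∀ {p q r} → p ≅³ q → q ≅³ r → p ≅³ r
      ≅³-trans (a , b , c) (a′ , b′ , c′) =
        ≅ᶠ-Setoid.trans a a′ , ↭ᴱ-Setoid.trans b b′ , ≅ᶠ-Setoid.trans c c′

      expand : ∀ t u f φ → ∑ (outcomes (t ∷ u ∷ f)) φ ≈
        ∑ (contributions t) (λ p → ∑ (contributions u) (λ q →
          ∑ (outcomes f) (λ r → φ (p ⊞ q ⊞ r))))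
      expand t u f φ = trans (∑-outcomes-∷ t (u ∷ f) φ)
        (∑-cong (contributions t) (λ p → ∑-outcomes-∷ u f (λ q → φ (p ⊞ q))))
    ∑-outcomes-cong (Homogeneous.trans p q) {φ} {φ′} e = trans
      (∑-outcomes-cong p {φ} {φ} (λ e₁ → trans (e e₁) (sym (e ≅³-refl))))
      (∑-outcomes-cong q {φ} {φ′} e)

    ∑-outcomes-congᵖ : ∀ {f f′} → Pointwise _≅_ f f′ → ∀ {φ φ′} → φ ≈³ φ′ →
                       ∑ (outcomes f) φ ≈ ∑ (outcomes f′) φ′
    ∑-outcomes-congᵖ []                             e = ∙-cong (e ≅³-refl) refl
    ∑-outcomes-congᵖ (_∷_ {t} {u} {f} {f′} t≅u es) {φ} {φ′} e = begin
      ∑ (outcomes (t ∷ f)) φ   ≈⟨ ∑-outcomes-∷ t f φ ⟩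
      _                        ≈⟨ ∑-contributions-cong t≅u (λ e₁ →
                                    ∑-outcomes-congᵖ es (λ e₂ → e (⊞-cong e₁ e₂))) ⟩
      _                        ≈⟨ ∑-outcomes-∷ u f′ φ′ ⟨
      ∑ (outcomes (u ∷ f′)) φ′ ∎

    ∑-outcomes-cong-∷ : ∀ {t u f f′} → t ≅ u → f ≅ᶠ f′ → ∀ {φ φ′} → φ ≈³ φ′ →
                        ∑ (outcomes (t ∷ f)) φ ≈ ∑ (outcomes (u ∷ f′)) φ′
    ∑-outcomes-cong-∷ {t} {u} {f} {f′} t≅u p {φ} {φ′} e = begin
      ∑ (outcomes (t ∷ f)) φ   ≈⟨ ∑-outcomes-∷ t f φ ⟩
      _                        ≈⟨ ∑-contributions-cong t≅u (λ e₁ →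
                                    ∑-outcomes-cong p (λ e₂ → e (⊞-cong e₁ e₂))) ⟩
      _                        ≈⟨ ∑-outcomes-∷ u f′ φ′ ⟨
      ∑ (outcomes (u ∷ f′)) φ′ ∎

    ∑-contributions-cong : ∀ {t u} → t ≅ u → ∀ {φ φ′} → φ ≈³ φ′ →
                           ∑ (contributions t) φ ≈ ∑ (contributions u) φ′
    ∑-contributions-cong (node {ts = ts} {us} p) {φ} {φ′} e = begin
      ∑ (contributions (node tt ts)) φ
        ≈⟨ split ts φ ⟩
      ∑ (outcomes ts) (φ ∘ cut) ∙ ∑ (outcomes ts) (φ ∘ keep)
        ≈⟨ ∙-cong (∑-outcomes-cong p (λ e₁ → e (cut-cong e₁)))
                  (∑-outcomes-cong p (λ e₁ → e (keep-cong e₁))) ⟩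
      ∑ (outcomes us) (φ′ ∘ cut) ∙ ∑ (outcomes us) (φ′ ∘ keep)
        ≈⟨ split us φ′ ⟨
      ∑ (contributions (node tt us)) φ′ ∎
      where
      split : ∀ ts φ → ∑ (contributions (node tt ts)) φ ≈
              ∑ (outcomes ts) (φ ∘ cut) ∙ ∑ (outcomes ts) (φ ∘ keep)
      split ts φ = trans (∑-++ (map cut (outcomes ts)) _ φ)
        (∙-cong (∑-map cut (outcomes ts) φ) (∑-map keep (outcomes ts) φ))

  ∑-subforests-cong : ∀ {t u} → t ≅ u → (ψ : List EdgeTree → RootedTree → Carrier) →
    (∀ {y y′ z z′} → y ↭ᴱ y′ → z ≅ z′ → ψ y z ≈ ψ y′ z′) →
    ∑ (subforests t) (λ s → ψ (components s) (contract s)) ≈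
    ∑ (subforests u) (λ s → ψ (components s) (contract s))
  ∑-subforests-cong (node {ts = ts} {us} p) ψ e = begin
    _ ≈⟨ ∑-subforests ts ψ ⟩
    _ ≈⟨ ∑-outcomes-cong p (λ (a , b , c) → e (↭ᴱ.++⁺ (rootComponent-cong a) b) (node c)) ⟩
    _ ≈⟨ ∑-subforests us ψ ⟨
    _ ∎

-- Maps of vertices preserving labels and order.
record VertexMap {A : Set} (f f′ : Forest A) : Set where
  field
    to       : Vertex f → Vertex f′
    to-label : ∀ x → label (to x) ≡ label x
    to-≺     : ∀ {x y} → x ≺ y → to x ≺ to y

open VertexMap

module _ {A : Set} where

  idᵛ : ∀ {f : Forest A} → VertexMap f f
  idᵛ = record { to = id ; to-label = λ _ → ≡.refl ; to-≺ = id }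

  _∘ᵛ_ : ∀ {f g h : Forest A} → VertexMap g h → VertexMap f g → VertexMap f h
  β ∘ᵛ α = record
    { to       = to β ∘ to α
    ; to-label = λ x → ≡.trans (to-label β _) (to-label α x)
    ; to-≺     = to-≺ β ∘ to-≺ α
    }

  consᵛ : ∀ {a} {ts us f f′ : Forest A} → VertexMap ts us → VertexMap f f′ →
          VertexMap (node a ts ∷ f) (node a us ∷ f′)
  consᵛ α β = record
    { to       = λ { root → root ; (above x) → above (to α x) ; (next x) → next (to β x) }
    ; to-label = λ { root → ≡.refl ; (above x) → to-label α x ; (next x) → to-label β x }
    ; to-≺     = λ { root → root ; (above e) → above (to-≺ α e) ; (next e) → next (to-≺ β e) }
    }

  swapᵛ : ∀ {t u} {f : Forest A} → VertexMap (t ∷ u ∷ f) (u ∷ t ∷ f)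
  swapᵛ {t} {u} {f} = record { to = σ ; to-label = σ-label ; to-≺ = σ-≺ }
    where
    σ : Vertex (t ∷ u ∷ f) → Vertex (u ∷ t ∷ f)
    σ root             = next root
    σ (above x)        = next (above x)
    σ (next root)      = root
    σ (next (above x)) = above x
    σ (next (next x))  = next (next x)

    σ-label : ∀ x → label (σ x) ≡ label x
    σ-label root             = ≡.refl
    σ-label (above x)        = ≡.refl
    σ-label (next root)      = ≡.refl
    σ-label (next (above x)) = ≡.refl
    σ-label (next (next x))  = ≡.refl

    σ-≺ : ∀ {x y} → x ≺ y → σ x ≺ σ y
    σ-≺ root             = next root
    σ-≺ (above e)        = next (above e)
    σ-≺ (next root)      = root
    σ-≺ (next (above e)) = above e
    σ-≺ (next (next e))  = next (next e)

  mutual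
    vertexMap : ∀ {f f′ : Forest A} → f ≅ᶠ f′ → VertexMap f f′
    vertexMap (Homogeneous.refl es)                      = vertexMapᵖ es
    vertexMap (Homogeneous.prep (node p) q)              = consᵛ (vertexMap p) (vertexMap q)
    vertexMap (Homogeneous.swap (node p) (node p′) q)    =
      swapᵛ ∘ᵛ consᵛ (vertexMap p) (consᵛ (vertexMap p′) (vertexMap q))
    vertexMap (Homogeneous.trans p q)                    = vertexMap q ∘ᵛ vertexMap p

    vertexMapᵖ : ∀ {f f′ : Forest A} → Pointwise _≅_ f f′ → VertexMap f f′
    vertexMapᵖ []            = idᵛ
    vertexMapᵖ (node p ∷ es) = consᵛ (vertexMap p) (vertexMapᵖ es)

Admissible-resp : ∀ {u u′} → u ≅ᶠ u′ → Admissible u → Admissible u′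
Admissible-resp p adm _ _ x≺y (x∈V , y∈W) =
  adm _ _ (to-≺ α x≺y) (≡.trans (to-label α _) x∈V , ≡.trans (to-label α _) y∈W)
  where α = vertexMap (≅ᶠ-Setoid.sym p)

mutual
  induced-cong : ∀ p {u u′} → u ≅ᶠ u′ → induced p u ≅ᶠ induced p u′
  induced-cong p e = ≅ᶠ.++⁺ (atRoots-cong p e) (offRoots-cong p e)

  atRoots-cong : ∀ p {u u′} → u ≅ᶠ u′ → atRoots p u ≅ᶠ atRoots p u′
  atRoots-cong p (Homogeneous.refl es)     = atRoots-congᵖ p es
  atRoots-cong p (Homogeneous.prep e q)    = ≅ᶠ.++⁺ (atRootᵗ-cong p e) (atRoots-cong p q)
  atRoots-cong p (Homogeneous.swap {x = t} {u} e e′ q) = ≅ᶠ-Setoid.trans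
    (≅ᶠ.shifts (atRootᵗ p t) (atRootᵗ p u))
    (≅ᶠ.++⁺ (atRootᵗ-cong p e′) (≅ᶠ.++⁺ (atRootᵗ-cong p e) (atRoots-cong p q)))
  atRoots-cong p (Homogeneous.trans q q′)  =
    ≅ᶠ-Setoid.trans (atRoots-cong p q) (atRoots-cong p q′)

  atRoots-congᵖ : ∀ p {u u′} → Pointwise _≅_ u u′ → atRoots p u ≅ᶠ atRoots p u′
  atRoots-congᵖ p []       = ≅ᶠ-Setoid.refl
  atRoots-congᵖ p (e ∷ es) = ≅ᶠ.++⁺ (atRootᵗ-cong p e) (atRoots-congᵖ p es)

  offRoots-cong : ∀ p {u u′} → u ≅ᶠ u′ → offRoots p u ≅ᶠ offRoots p u′
  offRoots-cong p (Homogeneous.refl es)     = offRoots-congᵖ p es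
  offRoots-cong p (Homogeneous.prep e q)    = ≅ᶠ.++⁺ (offRootᵗ-cong p e) (offRoots-cong p q)
  offRoots-cong p (Homogeneous.swap {x = t} {u} e e′ q) = ≅ᶠ-Setoid.trans
    (≅ᶠ.shifts (offRootᵗ p t) (offRootᵗ p u))
    (≅ᶠ.++⁺ (offRootᵗ-cong p e′) (≅ᶠ.++⁺ (offRootᵗ-cong p e) (offRoots-cong p q)))
  offRoots-cong p (Homogeneous.trans q q′)  =
    ≅ᶠ-Setoid.trans (offRoots-cong p q) (offRoots-cong p q′)

  offRoots-congᵖ : ∀ p {u u′} → Pointwise _≅_ u u′ → offRoots p u ≅ᶠ offRoots p u′
  offRoots-congᵖ p []       = ≅ᶠ-Setoid.refl
  offRoots-congᵖ p (e ∷ es) = ≅ᶠ.++⁺ (offRootᵗ-cong p e) (offRoots-congᵖ p es)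

  atRootᵗ-cong : ∀ p {t t′} → t ≅ t′ → atRootᵗ p t ≅ᶠ atRootᵗ p t′
  atRootᵗ-cong p (node {a = q} e) with does (p ≟ q)
  ... | true  = Homogeneous.prep (node (atRoots-cong p e)) ≅ᶠ-Setoid.refl
  ... | false = ≅ᶠ-Setoid.refl

  offRootᵗ-cong : ∀ p {t t′} → t ≅ t′ → offRootᵗ p t ≅ᶠ offRootᵗ p t′
  offRootᵗ-cong p (node {a = q} e) with does (p ≟ q)
  ... | true  = offRoots-cong p e
  ... | false = ≅ᶠ.++⁺ (atRoots-cong p e) (offRoots-cong p e)

module DecompositionSums {m ℓm} (M : CommutativeMonoid m ℓm) where
  open CommutativeMonoid M
  open Summation M
  open SetoidReasoning setoid

  open Homogeneous using (prep; swap)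

  ∑-labellingsᶠ-∷ : ∀ t f φ → ∑ (labellingsᶠ (t ∷ f)) φ ≈
    ∑ (labellings t) (λ l → ∑ (labellingsᶠ f) (λ m → φ (l ∷ m)))
  ∑-labellingsᶠ-∷ t f φ = ∑-cartesianProductWith _∷_ (labellings t) (labellingsᶠ f) φ

  mutual
    ∑-labellingsᶠ-cong : ∀ {f f′} → f ≅ᶠ f′ → {φ φ′ : Forest Part → Carrier} →
      (∀ {l l′} → l ≅ᶠ l′ → φ l ≈ φ′ l′) →
      ∑ (labellingsᶠ f) φ ≈ ∑ (labellingsᶠ f′) φ′
    ∑-labellingsᶠ-cong (Homogeneous.refl es) e = ∑-labellingsᶠ-congᵖ es e
    ∑-labellingsᶠ-cong (prep {f} {f′} {t} {u} t≅u p) {φ} {φ′} e = begin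
      _ ≈⟨ ∑-labellingsᶠ-∷ t f φ ⟩
      _ ≈⟨ ∑-labellings-cong t≅u (λ e₁ → ∑-labellingsᶠ-cong p (λ e₂ → e (prep e₁ e₂))) ⟩
      _ ≈⟨ ∑-labellingsᶠ-∷ u f′ φ′ ⟨
      _ ∎
    ∑-labellingsᶠ-cong (swap {f} {f′} {t} {u} {t′} {u′} t≅t′ u≅u′ p) {φ} {φ′} e = begin
      _ ≈⟨ expand t u f φ ⟩
      _ ≈⟨ ∑-labellings-cong t≅t′ (λ e₁ → ∑-labellings-cong u≅u′ (λ e₂ →
             ∑-labellingsᶠ-cong p (λ e₃ → e (swap e₁ e₂ e₃)))) ⟩
      _ ≈⟨ ∑-swap (labellings t′) (labellings u′)
             (λ l m → ∑ (labellingsᶠ f′) (λ n → φ′ (m ∷ l ∷ n))) ⟩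
      _ ≈⟨ expand u′ t′ f′ φ′ ⟨
      _ ∎
      where
      expand : ∀ t u f φ → ∑ (labellingsᶠ (t ∷ u ∷ f)) φ ≈
        ∑ (labellings t) (λ l → ∑ (labellings u) (λ m →
          ∑ (labellingsᶠ f) (λ n → φ (l ∷ m ∷ n))))
      expand t u f φ = trans (∑-labellingsᶠ-∷ t (u ∷ f) φ)
        (∑-cong (labellings t) (λ l → ∑-labellingsᶠ-∷ u f (λ m → φ (l ∷ m))))
    ∑-labellingsᶠ-cong (Homogeneous.trans p q) {φ} {φ′} e = trans
      (∑-labellingsᶠ-cong p {φ} {φ} (λ e₁ → trans (e e₁) (sym (e ≅ᶠ-Setoid.refl))))
      (∑-labellingsᶠ-cong q {φ} {φ′} e)

    ∑-labellingsᶠ-congᵖ : ∀ {f f′} → Pointwise _≅_ f f′ → {φ φ′ : Forest Part → Carrier} →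
      (∀ {l l′} → l ≅ᶠ l′ → φ l ≈ φ′ l′) →
      ∑ (labellingsᶠ f) φ ≈ ∑ (labellingsᶠ f′) φ′
    ∑-labellingsᶠ-congᵖ [] e = ∙-cong (e ≅ᶠ-Setoid.refl) refl
    ∑-labellingsᶠ-congᵖ (_∷_ {t} {u} {f} {f′} t≅u es) {φ} {φ′} e = begin
      _ ≈⟨ ∑-labellingsᶠ-∷ t f φ ⟩
      _ ≈⟨ ∑-labellings-cong t≅u (λ e₁ → ∑-labellingsᶠ-congᵖ es (λ e₂ → e (prep e₁ e₂))) ⟩
      _ ≈⟨ ∑-labellingsᶠ-∷ u f′ φ′ ⟨
      _ ∎

    ∑-labellings-cong : ∀ {t u} → t ≅ u → {φ φ′ : Tree Part → Carrier} →
      (∀ {l l′} → l ≅ l′ → φ l ≈ φ′ l′) →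
      ∑ (labellings t) φ ≈ ∑ (labellings u) φ′
    ∑-labellings-cong (node {ts = ts} {us} p) {φ} {φ′} e = begin
      _ ≈⟨ ∑-cartesianProductWith node (V ∷ W ∷ []) (labellingsᶠ ts) φ ⟩
      _ ≈⟨ ∑-cong (V ∷ W ∷ []) {λ a → ∑ (labellingsᶠ ts) (λ l → φ (node a l))}
             (λ a → ∑-labellingsᶠ-cong p (λ e₁ → e (node {a = a} e₁))) ⟩
      _ ≈⟨ ∑-cartesianProductWith node (V ∷ W ∷ []) (labellingsᶠ us) φ′ ⟨
      _ ∎

  ∑-decompositions-cong : ∀ {u u′} → u ≅ᶠ u′ → (φ : Forest Part → Carrier) →
    (∀ {l l′} → l ≅ᶠ l′ → φ l ≈ φ l′) →
    ∑ (decompositions u) φ ≈ ∑ (decompositions u′) φ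
  ∑-decompositions-cong {u} {u′} p φ e = begin
    _ ≈⟨ ∑-filter admissible? (labellingsᶠ u) φ ⟩
    _ ≈⟨ ∑-labellingsᶠ-cong p restrict ⟩
    _ ≈⟨ ∑-filter admissible? (labellingsᶠ u′) φ ⟨
    _ ∎
    where
    restrict : ∀ {l l′} → l ≅ᶠ l′ → (if does (admissible? l) then φ l else ε) ≈
                                    (if does (admissible? l′) then φ l′ else ε)
    restrict {l} {l′} q with admissible? l | admissible? l′
    ... | yes _ | yes _ = e q
    ... | no _  | no _  = refl
    ... | yes a | no b  = contradiction (Admissible-resp q a) b
    ... | no a  | yes b = contradiction (Admissible-resp (≅ᶠ-Setoid.sym q) b) a

------------------------------------------------------------------------
-- The algebras of trees and forests, and the maps between them

module Trees {c ℓ} (R : CommutativeRing c ℓ) where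
  open LinearAlgebra R public

  -- The one-vertex tree is identified with the unit of 𝓗, the empty monomial.
  𝓗 : CommutativeAlgebra c (c ⊔ ℓ)
  𝓗 = FreeAlgebra edgeTreeSetoid

  𝓗CK : CommutativeAlgebra c (c ⊔ ℓ)
  𝓗CK = FreeAlgebra (treeSetoid ⊤)

  H HCK : Mod c (c ⊔ ℓ)
  H   = mod 𝓗
  HCK = mod 𝓗CK

  ΔCK-forest : RootedForest → LeftModule.Carrierᴹ (HCK ⊗ HCK)
  ΔCK-forest u = ∑ᴹ (HCK ⊗ HCK) (decompositions u) λ l →
    gen (induced V l) ⊗ₜ gen (induced W l)

  ΔCK-forest-cong : ∀ {u u′} → u ≅ᶠ u′ →
                    LeftModule._≈ᴹ_ (HCK ⊗ HCK) (ΔCK-forest u) (ΔCK-forest u′)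
  ΔCK-forest-cong p = ∑-decompositions-cong p (λ l → gen (induced V l) ⊗ₜ gen (induced W l))
    λ e → rel (⊗-cong {M = HCK} {N = HCK}
      (rel (gen-cong (induced-cong V e))) (rel (gen-cong (induced-cong W e))))
    where open DecompositionSums (LeftModule.+ᴹ-commutativeMonoid (HCK ⊗ HCK))

  ΔCK : HCK ⊸ HCK ⊗ HCK
  ΔCK = freeLift (Monomial (treeSetoid ⊤)) (HCK ⊗ HCK) ΔCK-forest ΔCK-forest-cong

  Φ-tree : RootedTree → LeftModule.Carrierᴹ (H ⊗ HCK)
  Φ-tree t = ∑ᴹ (H ⊗ HCK) (subforests t) λ s →
    gen (components s) ⊗ₜ gen [ contract s ]

  Φ-tree-cong : ∀ {t t′} → t ≅ t′ →
                LeftModule._≈ᴹ_ (H ⊗ HCK) (Φ-tree t) (Φ-tree t′)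
  Φ-tree-cong t≅t′ = ∑-subforests-cong t≅t′ (λ y z → gen y ⊗ₜ gen [ z ])
    λ e e′ → rel (⊗-cong {M = H} {N = HCK}
      (rel (gen-cong e)) (rel (gen-cong (Homogeneous.prep e′ ≅ᶠ-Setoid.refl))))
    where open SubforestSums (LeftModule.+ᴹ-commutativeMonoid (H ⊗ HCK))

  ΦHom : AlgebraHom 𝓗CK (𝓗 ⊗ᴬ 𝓗CK)
  ΦHom = algebraLift (treeSetoid ⊤) (𝓗 ⊗ᴬ 𝓗CK) Φ-tree Φ-tree-cong

  Φ : HCK ⊸ H ⊗ HCK
  Φ = AlgebraHom.linearMap ΦHom

  m¹³ : (H ⊗ HCK) ⊗ (H ⊗ HCK) ⊸ H ⊗ (HCK ⊗ HCK)
  m¹³ = interchange (CommutativeAlgebra.μ 𝓗) idₗ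

  m¹³-⊗ : ∀ a b c d → ⟦ m¹³ ⟧ ((a ⊗ₜ b) ⊗ₜ (c ⊗ₜ d)) ≡ CommutativeAlgebra._*_ 𝓗 a c ⊗ₜ (b ⊗ₜ d)
  m¹³-⊗ a b c d = ≡.refl

{-# OPTIONS --safe #-}
module Submission where

-- Let 𝒪(f) be the sum, over all ways of growing a subtree from an extra root
-- below f and choosing further components avoiding it, of x ⊗ y ⊗ z, where x
-- is the forest of branches of that subtree, y the product of the other
-- components and z the forest left on the root by the contraction. Then
--
--   (id ⊗ id ⊗ ΔCK) 𝒪(f) = ∑ over (v , w) in ΔCK(f) of x ⊗ s y ⊗ p ⊗ z,
--   with s ⊗ p in Φ(v) and x ⊗ y ⊗ z in 𝒪(w).
--
-- Both sides are multiplicative in f. For a tree with branches ts, the terms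
-- of 𝒪 split according to whether the edge below the tree is cut or kept, and
-- those of ΔCK according to whether its root lies in V or W; everything then
-- reduces to the identity for ts. The terms with x empty form the theorem.

open import Defs
open import Algebra.Apartness.Bundles using (HeytingField)
open import Algebra.Bundles using (CommutativeMonoid; CommutativeRing)
open import Algebra.Module.Bundles using (LeftModule)
open import Data.Bool.Base using (Bool; true; false; _∧_; if_then_else_)
open import Data.List.Base
  using (List; []; _∷_; [_]; _++_; map; null; cartesianProductWith)
open import Data.List.Properties using (++-assoc; ++-identityʳ)
import Data.List.Relation.Binary.Permutation.Homogeneous as Homogeneous
open import Data.Product.Base using (_×_; _,_; proj₁; proj₂; map₂; zip′)
open import Data.Unit.Base using (tt)
open import Function.Base using (_∘_)
open import Relation.Binary.PropositionalEquality.Core as ≡ using (_≡_)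
import Relation.Binary.Reasoning.Setoid as SetoidReasoning
open import Relation.Nullary using (does)
open import Relation.Nullary.Decidable using (_×-dec_; ¬?)

-- Recursive lists of cuts and contractions.

-- The pairs (v , w) of ΔCK: the root of a tree either lies in V, and then so
-- does the whole tree, or it lies in W.
mutual
  cutsᵗ : RootedTree → List (RootedForest × RootedForest)
  cutsᵗ t@(node tt ts) = ([ t ] , []) ∷ map (map₂ λ w → [ node tt w ]) (cuts ts)

  cuts : RootedForest → List (RootedForest × RootedForest)
  cuts []      = [ [] , [] ]
  cuts (t ∷ f) = cartesianProductWith (zip′ _++_ _++_) (cutsᵗ t) (cuts f)

-- The pairs (s , t/s) for the subforests s of t.
contractionsᵗ : RootedTree → List (List EdgeTree × RootedForest)
contractionsᵗ (node tt ts) =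
  map (λ (x , y , z) → rootComponent x ++ y , [ node tt z ]) (outcomes ts)

contractions : RootedForest → List (List EdgeTree × RootedForest)
contractions []      = [ [] , [] ]
contractions (t ∷ f) =
  cartesianProductWith (zip′ _++_ _++_) (contractionsᵗ t) (contractions f)

-- Labellings admissible for ordered decompositions.

mutual
  -- A root in V forces every vertex above it into V, so this is the only labelling that may be
  -- grafted onto such a root.
  allV : RootedForest → Forest Part
  allV []      = []
  allV (t ∷ f) = allVᵗ t ∷ allV f

  allVᵗ : RootedTree → Tree Part
  allVᵗ (node tt ts) = node V (allV ts)

atRoots-V-allV : ∀ f → atRoots V (allV f) ≡ f
atRoots-V-allV []               = ≡.refl
atRoots-V-allV (node tt ts ∷ f) =
  ≡.cong₂ (λ ts f → node tt ts ∷ f) (atRoots-V-allV ts) (atRoots-V-allV f)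

offRoots-V-allV : ∀ f → offRoots V (allV f) ≡ []
offRoots-V-allV []               = ≡.refl
offRoots-V-allV (node tt ts ∷ f) = ≡.cong₂ _++_ (offRoots-V-allV ts) (offRoots-V-allV f)

mutual
  atRoots-W-allV : ∀ f → atRoots W (allV f) ≡ []
  atRoots-W-allV []               = ≡.refl
  atRoots-W-allV (node tt ts ∷ f) = atRoots-W-allV f

  offRoots-W-allV : ∀ f → offRoots W (allV f) ≡ []
  offRoots-W-allV []               = ≡.refl
  offRoots-W-allV (node tt ts ∷ f) = ≡.cong₂ _++_ (induced-W-allV ts) (offRoots-W-allV f)

  induced-W-allV : ∀ f → induced W (allV f) ≡ []
  induced-W-allV f = ≡.cong₂ _++_ (atRoots-W-allV f) (offRoots-W-allV f)

-- Whether grafting l onto a vertex labelled p puts no vertex of W above one of V.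
mayCarry : Part → Forest Part → Bool
mayCarry p l = does (allLabels? (λ q → ¬? ((p ≟ V) ×-dec (q ≟ W))) l)

mayCarry-W : ∀ l → mayCarry W l ≡ true
mayCarry-W []             = ≡.refl
mayCarry-W (node _ l ∷ m) = ≡.cong₂ _∧_ (mayCarry-W l) (mayCarry-W m)

admissible-allV : ∀ f → does (admissible? (allV f)) ≡ true
admissible-allV []               = ≡.refl
admissible-allV (node tt ts ∷ f) =
  ≡.cong₂ _∧_ (mayCarry-V ts) (≡.cong₂ _∧_ (admissible-allV ts) (admissible-allV f))
  where
  mayCarry-V : ∀ f → mayCarry V (allV f) ≡ true
  mayCarry-V []               = ≡.refl
  mayCarry-V (node tt ts ∷ f) = ≡.cong₂ _∧_ (mayCarry-V ts) (mayCarry-V f)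

mutual
  atRoots-W-mayCarry : ∀ l → mayCarry V l ≡ true → atRoots W l ≡ []
  atRoots-W-mayCarry []             e = ≡.refl
  -- A first root labelled W would turn the hypothesis into `false ≡ true`, so only roots in V
  -- remain.
  atRoots-W-mayCarry (node V l ∷ m) e with mayCarry V l | e
  ... | true | e = atRoots-W-mayCarry m e

  offRoots-W-mayCarry : ∀ l → mayCarry V l ≡ true → offRoots W l ≡ []
  offRoots-W-mayCarry []             e = ≡.refl
  offRoots-W-mayCarry (node V l ∷ m) e with mayCarry V l in eq | e
  ... | true | e = ≡.cong₂ _++_
    (≡.cong₂ _++_ (atRoots-W-mayCarry l eq) (offRoots-W-mayCarry l eq))
    (offRoots-W-mayCarry m e)

-- In an admissible decomposition W is closed under passing to the root.
offRoots-W-admissible : ∀ l → does (admissible? l) ≡ true → offRoots W l ≡ []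
offRoots-W-admissible []             e = ≡.refl
offRoots-W-admissible (node V l ∷ m) e with mayCarry V l in eq | does (admissible? l) | e
... | true | true | e = ≡.cong₂ _++_
  (≡.cong₂ _++_ (atRoots-W-mayCarry l eq) (offRoots-W-mayCarry l eq))
  (offRoots-W-admissible m e)
offRoots-W-admissible (node W l ∷ m) e with mayCarry W l | does (admissible? l) in eq | e
... | true | true | e = ≡.cong₂ _++_ (offRoots-W-admissible l eq) (offRoots-W-admissible m e)

-- Guarded sums and sums over concatenated forests.

module Sums {m ℓm} (M : CommutativeMonoid m ℓm) where
  open CommutativeMonoid M
  open Summation M
  open SubforestSums M
  open DecompositionSums M using (∑-labellingsᶠ-∷)
  open SetoidReasoning setoid

  guard : Bool → Carrier → Carrier
  guard b x = if b then x else ε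

  -- The equation may be proved under the assumption that the guard holds; this is how admissibility
  -- of a labelling becomes available inside a sum.
  guard-cong : ∀ b {x y} → (b ≡ true → x ≈ y) → guard b x ≈ guard b y
  guard-cong true  e = e ≡.refl
  guard-cong false e = refl

  guard-true : ∀ {b} x → b ≡ true → guard b x ≈ x
  guard-true x ≡.refl = refl

  guard-∧ : ∀ a b x → guard (a ∧ b) x ≡ guard a (guard b x)
  guard-∧ true  b x = ≡.refl
  guard-∧ false b x = ≡.refl

  ∑-guard : ∀ {a} {A : Set a} b (xs : List A) φ →
            ∑ xs (λ x → guard b (φ x)) ≈ guard b (∑ xs φ)
  ∑-guard true  xs φ = refl
  ∑-guard false xs φ = ∑-ε xs

  -- `cuts`, `contractions` and `outcomes` are families in a monoid built tree by tree, so each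
  -- turns concatenation of forests into products. The hypotheses speak of sums against an arbitrary
  -- `φ` because `outcomes` is not listed in product order; the monoid laws are propositional
  -- equalities, so `φ` needs no congruence property.
  module Multiplicative
    {P : Set} (_⋆_ : P → P → P) (1ᴾ : P)
    (⋆-assoc : ∀ p q r → (p ⋆ q) ⋆ r ≡ p ⋆ (q ⋆ r)) (⋆-identityˡ : ∀ p → 1ᴾ ⋆ p ≡ p)
    (⋆-identityʳ : ∀ p → p ⋆ 1ᴾ ≡ p)
    (Fᵗ : RootedTree → List P) (F : RootedForest → List P)
    (F-[] : ∀ φ → ∑ (F []) φ ≈ φ 1ᴾ)
    (F-∷ : ∀ t f φ → ∑ (F (t ∷ f)) φ ≈ ∑ (Fᵗ t) λ p → ∑ (F f) λ q → φ (p ⋆ q))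
    where

    ∑-F-++ : ∀ f f′ φ → ∑ (F (f ++ f′)) φ ≈ ∑ (F f) λ p → ∑ (F f′) λ q → φ (p ⋆ q)
    ∑-F-++ []      f′ φ = begin
      ∑ (F f′) φ
        ≈⟨ ∑-cong (F f′) (λ q → reflexive (≡.cong φ (⋆-identityˡ q))) ⟨
      ∑ (F f′) (λ q → φ (1ᴾ ⋆ q))
        ≈⟨ F-[] _ ⟨
      ∑ (F []) (λ p → ∑ (F f′) λ q → φ (p ⋆ q)) ∎
    ∑-F-++ (t ∷ f) f′ φ = begin
      ∑ (F (t ∷ f ++ f′)) φ
        ≈⟨ F-∷ t (f ++ f′) φ ⟩
      ∑ (Fᵗ t) (λ p → ∑ (F (f ++ f′)) λ q → φ (p ⋆ q))
        ≈⟨ ∑-cong (Fᵗ t) (λ p → ∑-F-++ f f′ _) ⟩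
      ∑ (Fᵗ t) (λ p → ∑ (F f) λ q → ∑ (F f′) λ r → φ (p ⋆ (q ⋆ r)))
        ≈⟨ ∑-cong (Fᵗ t) (λ p → ∑-cong (F f) λ q → ∑-cong (F f′) λ r →
             reflexive (≡.cong φ (⋆-assoc p q r))) ⟨
      ∑ (Fᵗ t) (λ p → ∑ (F f) λ q → ∑ (F f′) λ r → φ ((p ⋆ q) ⋆ r))
        ≈⟨ F-∷ t f _ ⟨
      ∑ (F (t ∷ f)) (λ p → ∑ (F f′) λ q → φ (p ⋆ q)) ∎

    ∑-F-[-] : ∀ t φ → ∑ (F [ t ]) φ ≈ ∑ (Fᵗ t) φ
    ∑-F-[-] t φ = trans (F-∷ t [] φ) (∑-cong (Fᵗ t) λ p →
      trans (F-[] _) (reflexive (≡.cong φ (⋆-identityʳ p))))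

  ∑-cuts-∷ : ∀ t f φ → ∑ (cuts (t ∷ f)) φ ≈
             ∑ (cutsᵗ t) λ p → ∑ (cuts f) λ q → φ (zip′ _++_ _++_ p q)
  ∑-cuts-∷ t f = ∑-cartesianProductWith _ (cutsᵗ t) (cuts f)

  ∑-contractions-∷ : ∀ t f φ → ∑ (contractions (t ∷ f)) φ ≈
    ∑ (contractionsᵗ t) λ p → ∑ (contractions f) λ q → φ (zip′ _++_ _++_ p q)
  ∑-contractions-∷ t f = ∑-cartesianProductWith _ (contractionsᵗ t) (contractions f)

  private
    zip-assoc : ∀ {A B : Set} (p q r : List A × List B) →
                zip′ _++_ _++_ (zip′ _++_ _++_ p q) r ≡ zip′ _++_ _++_ p (zip′ _++_ _++_ q r)
    zip-assoc (a , b) (a′ , b′) (a″ , b″) = ≡.cong₂ _,_ (++-assoc a a′ a″) (++-assoc b b′ b″)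

    ⊞-assoc : ∀ p q r → (p ⊞ q) ⊞ r ≡ p ⊞ (q ⊞ r)
    ⊞-assoc (a , p) (a′ , q) (a″ , r) = ≡.cong₂ _,_ (++-assoc a a′ a″) (zip-assoc p q r)

    zip-identityʳ : ∀ {A B : Set} (p : List A × List B) → zip′ _++_ _++_ p ([] , []) ≡ p
    zip-identityʳ (a , b) = ≡.cong₂ _,_ (++-identityʳ a) (++-identityʳ b)

    ⊞-identityʳ : ∀ p → p ⊞ ([] , [] , []) ≡ p
    ⊞-identityʳ (a , p) = ≡.cong₂ _,_ (++-identityʳ a) (zip-identityʳ p)

  open Multiplicative (zip′ _++_ _++_) ([] , []) zip-assoc (λ _ → ≡.refl) zip-identityʳ
    cutsᵗ cuts (λ φ → identityʳ _) ∑-cuts-∷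
    using () renaming (∑-F-++ to ∑-cuts-++; ∑-F-[-] to ∑-cuts-[-])

  open Multiplicative (zip′ _++_ _++_) ([] , []) zip-assoc (λ _ → ≡.refl) zip-identityʳ
    contractionsᵗ contractions (λ φ → identityʳ _) ∑-contractions-∷
    using () renaming (∑-F-++ to ∑-contractions-++; ∑-F-[-] to ∑-contractions-[-])

  open Multiplicative _⊞_ ([] , [] , []) ⊞-assoc (λ _ → ≡.refl) ⊞-identityʳ
    contributions outcomes (λ φ → identityʳ _) ∑-outcomes-∷
    using () renaming (∑-F-++ to ∑-outcomes-++; ∑-F-[-] to ∑-outcomes-[-])

  ∑-cutsᵗ : ∀ ts φ → ∑ (cutsᵗ (node tt ts)) φ ≈
            φ ([ node tt ts ] , []) ∙ ∑ (cuts ts) λ (v , w) → φ (v , [ node tt w ])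
  ∑-cutsᵗ ts φ = ∙-congˡ (∑-map _ (cuts ts) φ)

  ∑-contributions : ∀ ts φ → ∑ (contributions (node tt ts)) φ ≈
                    ∑ (outcomes ts) (φ ∘ cut) ∙ ∑ (outcomes ts) (φ ∘ keep)
  ∑-contributions ts φ = trans (∑-++ (map cut (outcomes ts)) _ φ)
    (∙-cong (∑-map cut (outcomes ts) φ) (∑-map keep (outcomes ts) φ))

  -- At each root the label W makes the guard false and gives `ε`, while the label V splits the
  -- guard between the branches and the rest.
  ∑-mayCarry-V : ∀ f (χ : Forest Part → Carrier) →
                 ∑ (labellingsᶠ f) (λ l → guard (mayCarry V l) (χ l)) ≈ χ (allV f)
  ∑-mayCarry-V []               χ = identityʳ _
  ∑-mayCarry-V (node tt ts ∷ f) χ = begin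
    ∑ (labellingsᶠ (node tt ts ∷ f)) (λ l → guard (mayCarry V l) (χ l))
      ≈⟨ ∑-labellingsᶠ-∷ (node tt ts) f _ ⟩
    ∑ (labellings (node tt ts)) χ₁
      ≈⟨ ∑-cartesianProductWith node (V ∷ W ∷ []) (labellingsᶠ ts) χ₁ ⟩
    ∑ (labellingsᶠ ts) (λ l → χ₁ (node V l)) ∙ (∑ (labellingsᶠ ts) (λ l → χ₁ (node W l)) ∙ ε)
      ≈⟨ ∙-cong (∑-cong (labellingsᶠ ts) V-case)
           (trans (identityʳ _) (trans (∑-cong (labellingsᶠ ts) (λ l → ∑-ε (labellingsᶠ f)))
             (∑-ε (labellingsᶠ ts)))) ⟩
    ∑ (labellingsᶠ ts) (λ l → guard (mayCarry V l) (χ (node V l ∷ allV f))) ∙ ε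
      ≈⟨ identityʳ _ ⟩
    ∑ (labellingsᶠ ts) (λ l → guard (mayCarry V l) (χ (node V l ∷ allV f)))
      ≈⟨ ∑-mayCarry-V ts _ ⟩
    χ (allV (node tt ts ∷ f)) ∎
    where
    χ₁ : Tree Part → Carrier
    χ₁ l = ∑ (labellingsᶠ f) λ m → guard (mayCarry V (l ∷ m)) (χ (l ∷ m))

    V-case : ∀ l → χ₁ (node V l) ≈ guard (mayCarry V l) (χ (node V l ∷ allV f))
    V-case l = begin
      χ₁ (node V l)
        ≈⟨ ∑-cong (labellingsᶠ f) (λ m → reflexive (guard-∧ (mayCarry V l) (mayCarry V m) _)) ⟩
      ∑ (labellingsᶠ f) (λ m → guard (mayCarry V l) (guard (mayCarry V m) (χ (node V l ∷ m))))
        ≈⟨ ∑-guard (mayCarry V l) (labellingsᶠ f) _ ⟩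
      guard (mayCarry V l) (∑ (labellingsᶠ f) λ m → guard (mayCarry V m) (χ (node V l ∷ m)))
        ≈⟨ guard-cong (mayCarry V l) (λ _ → ∑-mayCarry-V f _) ⟩
      guard (mayCarry V l) (χ (node V l ∷ allV f)) ∎

  -- Ordered decompositions as cuts.

  adm : Forest Part → Bool
  adm l = does (admissible? l)

  -- A first root labelled V matches the cut that puts its tree wholly into v; one labelled W
  -- matches the cuts of its branches. `ψ` must not see reorderings of v, since `induced` lists the
  -- trees at roots before all others whereas `cuts` proceeds tree by tree.
  ∑-labellings-cuts : ∀ u (ψ : RootedForest → RootedForest → Carrier) →
    (∀ {v v′ w} → v ≅ᶠ v′ → ψ v w ≈ ψ v′ w) →
    ∑ (labellingsᶠ u) (λ l → guard (adm l) (ψ (induced V l) (induced W l))) ≈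
    ∑ (cuts u) (λ (v , w) → ψ v w)
  ∑-labellings-cuts []               ψ ψ-cong = refl
  ∑-labellings-cuts (node tt ts ∷ f) ψ ψ-cong = begin
    ∑ (labellingsᶠ (node tt ts ∷ f)) (λ l → guard (adm l) (ψ (induced V l) (induced W l)))
      ≈⟨ ∑-labellingsᶠ-∷ (node tt ts) f _ ⟩
    ∑ (labellings (node tt ts)) χ
      ≈⟨ ∑-cartesianProductWith node (V ∷ W ∷ []) (labellingsᶠ ts) χ ⟩
    ∑ (labellingsᶠ ts) (χ ∘ node V) ∙ (∑ (labellingsᶠ ts) (χ ∘ node W) ∙ ε)
      ≈⟨ ∙-cong V-case (trans (identityʳ _) W-case) ⟩
    ∑ (cuts f) (λ (v , w) → ψ (node tt ts ∷ v) w) ∙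
    ∑ (cuts ts) (λ (v , w) → ∑ (cuts f) λ (v′ , w′) → ψ (v ++ v′) (node tt w ∷ w′))
      ≈⟨ ∑-cutsᵗ ts _ ⟨
    _ ≈⟨ ∑-cuts-∷ (node tt ts) f _ ⟨
    ∑ (cuts (node tt ts ∷ f)) (λ (v , w) → ψ v w) ∎
    where
    ψ′ : Forest Part → Carrier
    ψ′ l = ψ (induced V l) (induced W l)

    χ : Tree Part → Carrier
    χ l = ∑ (labellingsᶠ f) λ m → guard (adm (l ∷ m)) (ψ′ (l ∷ m))

    factor : ∀ p l → χ (node p l) ≈ guard (mayCarry p l) (guard (adm l)
               (∑ (labellingsᶠ f) λ m → guard (adm m) (ψ′ (node p l ∷ m))))
    factor p l = begin
      χ (node p l)
        ≈⟨ ∑-cong (labellingsᶠ f) (λ m → reflexive (≡.trans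
             (guard-∧ (mayCarry p l) (adm l ∧ adm m) _)
             (≡.cong (guard (mayCarry p l)) (guard-∧ (adm l) (adm m) _)))) ⟩
      _ ≈⟨ ∑-guard (mayCarry p l) (labellingsᶠ f) _ ⟩
      _ ≈⟨ guard-cong (mayCarry p l) (λ _ → ∑-guard (adm l) (labellingsᶠ f) _) ⟩
      _ ∎

    V-case : ∑ (labellingsᶠ ts) (χ ∘ node V) ≈ ∑ (cuts f) (λ (v , w) → ψ (node tt ts ∷ v) w)
    V-case = begin
      ∑ (labellingsᶠ ts) (χ ∘ node V)
        ≈⟨ ∑-cong (labellingsᶠ ts) (factor V) ⟩
      _ ≈⟨ ∑-mayCarry-V ts _ ⟩
      guard (adm (allV ts)) (∑ (labellingsᶠ f) λ m → guard (adm m) (ψ′ (node V (allV ts) ∷ m)))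
        ≈⟨ guard-true _ (admissible-allV ts) ⟩
      ∑ (labellingsᶠ f) (λ m → guard (adm m) (ψ′ (node V (allV ts) ∷ m)))
        ≈⟨ ∑-cong (labellingsᶠ f) (λ m → guard-cong (adm m) (λ _ → reflexive (unfold m))) ⟩
      ∑ (labellingsᶠ f) (λ m → guard (adm m) (ψ (node tt ts ∷ induced V m) (induced W m)))
        ≈⟨ ∑-labellings-cuts f (λ v w → ψ (node tt ts ∷ v) w)
             (λ e → ψ-cong (Homogeneous.prep (≅-refl _) e)) ⟩
      ∑ (cuts f) (λ (v , w) → ψ (node tt ts ∷ v) w) ∎
      where
      unfold : ∀ m → ψ′ (node V (allV ts) ∷ m) ≡ ψ (node tt ts ∷ induced V m) (induced W m)
      unfold m rewrite atRoots-V-allV ts | offRoots-V-allV ts | induced-W-allV ts = ≡.refl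

    W-case : ∑ (labellingsᶠ ts) (χ ∘ node W) ≈
      ∑ (cuts ts) (λ (v , w) → ∑ (cuts f) λ (v′ , w′) → ψ (v ++ v′) (node tt w ∷ w′))
    W-case = begin
      ∑ (labellingsᶠ ts) (χ ∘ node W)
        ≈⟨ ∑-cong (labellingsᶠ ts) (factor W) ⟩
      _ ≈⟨ ∑-cong (labellingsᶠ ts) (λ l → guard-true _ (mayCarry-W l)) ⟩
      ∑ (labellingsᶠ ts) (λ l → guard (adm l)
        (∑ (labellingsᶠ f) λ m → guard (adm m) (ψ′ (node W l ∷ m))))
        ≈⟨ ∑-cong (labellingsᶠ ts) (λ l → guard-cong (adm l) λ l-adm →
             trans (∑-cong (labellingsᶠ f) λ m → guard-cong (adm m) λ m-adm →
                      unfold l m l-adm m-adm)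
                   (∑-labellings-cuts f
                     (λ v′ w′ → ψ (induced V l ++ v′) (node tt (induced W l) ∷ w′))
                     (λ e → ψ-cong (≅ᶠ.++⁺ˡ _ e)))) ⟩
      ∑ (labellingsᶠ ts) (λ l → guard (adm l) (∑ (cuts f) λ (v′ , w′) →
        ψ (induced V l ++ v′) (node tt (induced W l) ∷ w′)))
        ≈⟨ ∑-labellings-cuts ts
             (λ v w → ∑ (cuts f) λ (v′ , w′) → ψ (v ++ v′) (node tt w ∷ w′))
             (λ e → ∑-cong (cuts f) λ _ → ψ-cong (≅ᶠ.++⁺ʳ _ e)) ⟩
      ∑ (cuts ts) (λ (v , w) → ∑ (cuts f) λ (v′ , w′) → ψ (v ++ v′) (node tt w ∷ w′)) ∎
      where
      unfold : ∀ l m → adm l ≡ true → adm m ≡ true →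
        ψ′ (node W l ∷ m) ≈
        ψ (induced V l ++ induced V m) (node tt (induced W l) ∷ induced W m)
      -- Admissibility leaves in `l` no tree of W except those at its roots, so the W-forests agree
      -- exactly and only the V-trees need reordering.
      unfold l m l-adm m-adm
        rewrite offRoots-W-admissible l l-adm | ++-identityʳ (atRoots W l) =
        ψ-cong (≅ᶠ.shifts (atRoots V m) (induced V l))

  ∑-decompositions : ∀ u (ψ : RootedForest → RootedForest → Carrier) →
    (∀ {v v′ w} → v ≅ᶠ v′ → ψ v w ≈ ψ v′ w) →
    ∑ (decompositions u) (λ l → ψ (induced V l) (induced W l)) ≈
    ∑ (cuts u) (λ (v , w) → ψ v w)
  ∑-decompositions u ψ ψ-cong =
    trans (∑-filter admissible? (labellingsᶠ u) _) (∑-labellings-cuts u ψ ψ-cong)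

  -- The identity between outcomes and cuts, tested on weights.

  -- A weight φ x y a b stands for the tensor x ⊗ y ⊗ a ⊗ b in
  -- 𝓗CK ⊗ 𝓗 ⊗ 𝓗CK ⊗ 𝓗CK.
  Weight : Set _
  Weight = RootedForest → List EdgeTree → RootedForest → RootedForest → Carrier

  -- In the comparison below, x, a and b arise in the same order on both sides; only the components
  -- are permuted.
  ComponentInvariant : Weight → Set _
  ComponentInvariant φ = ∀ x {y y′} a b → y ↭ᴱ y′ → φ x y a b ≈ φ x y′ a b

  ∑-outcome-cuts : RootedForest → Weight → Carrier
  ∑-outcome-cuts f φ = ∑ (outcomes f) λ (x , y , z) → ∑ (cuts z) λ (a , b) → φ x y a b

  -- The components found in v and in w are multiplied, as in `m¹³`. The extra root counts as lying
  -- in W, so x comes from w alone.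
  ∑-parts : RootedForest × RootedForest → Weight → Carrier
  ∑-parts (v , w) φ =
    ∑ (contractions v) λ (s , p) → ∑ (outcomes w) λ (x , y , z) → φ x (s ++ y) p z

  ∑-cut-outcomes : RootedForest → Weight → Carrier
  ∑-cut-outcomes f φ = ∑ (cuts f) λ c → ∑-parts c φ

  ∑-parts-∑ : ∀ {a} {A : Set a} c (xs : List A) (φ : A → Weight) →
    ∑-parts c (λ x y a b → ∑ xs λ i → φ i x y a b) ≈ ∑ xs λ i → ∑-parts c (φ i)
  ∑-parts-∑ (v , w) xs φ = trans
    (∑-cong (contractions v) λ _ → ∑-swap (outcomes w) xs _)
    (∑-swap (contractions v) xs _)

  -- Freezes the data of the first tree, leaving a weight for the rest of the forest to which the
  -- induction hypothesis applies.
  shift : Weight → Triple → RootedForest → Weight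
  shift φ (x , y , a) b x′ y′ a′ b′ = φ (x ++ x′) (y ++ y′) (a ++ a′) (b ++ b′)

  -- Contractions and outcomes each split over concatenation; it remains to move s′ past y, which
  -- the invariance of `φ` in the components allows. This makes the right-hand side multiplicative.
  ∑-parts-++ : ∀ v w v′ w′ φ → ComponentInvariant φ →
    ∑-parts (v , w) (λ x y a b → ∑-parts (v′ , w′) (shift φ (x , y , a) b)) ≈
    ∑-parts (v ++ v′ , w ++ w′) φ
  ∑-parts-++ v w v′ w′ φ φ-cong = begin
    ∑-parts (v , w) (λ x y a b → ∑-parts (v′ , w′) (shift φ (x , y , a) b))
      ≈⟨ ∑-cong (contractions v) (λ _ → ∑-swap (outcomes w) (contractions v′) _) ⟩
    ∑ (contractions v) (λ (s , p) → ∑ (contractions v′) λ (s′ , p′) →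
      ∑ (outcomes w) λ (x , y , z) → ∑ (outcomes w′) λ (x′ , y′ , z′) →
        φ (x ++ x′) ((s ++ y) ++ (s′ ++ y′)) (p ++ p′) (z ++ z′))
      ≈⟨ ∑-cong (contractions v) (λ (s , p) → ∑-cong (contractions v′) λ (s′ , p′) → begin
           _ ≈⟨ ∑-cong (outcomes w) (λ (x , y , z) → ∑-cong (outcomes w′) λ (x′ , y′ , z′) →
                  φ-cong (x ++ x′) (p ++ p′) (z ++ z′) (interchange-++ s y s′ y′)) ⟩
           _ ≈⟨ ∑-outcomes-++ w w′ _ ⟨
           _ ∎) ⟩
    ∑ (contractions v) (λ (s , p) → ∑ (contractions v′) λ (s′ , p′) →
      ∑ (outcomes (w ++ w′)) λ (x , y , z) → φ x ((s ++ s′) ++ y) (p ++ p′) z)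
      ≈⟨ ∑-contractions-++ v v′ _ ⟨
    ∑-parts (v ++ v′ , w ++ w′) φ ∎
    where
    interchange-++ : ∀ s y s′ y′ → (s ++ y) ++ (s′ ++ y′) ↭ᴱ (s ++ s′) ++ (y ++ y′)
    interchange-++ = Summation.interchange ↭ᴱ.++-commutativeMonoid

  mutual
    -- The induction changes the weight: `shift` absorbs the first tree, and inside a tree the
    -- weight records whether the edge below was cut or kept. Hence the quantification over all `φ`.
    ∑-outcome-cuts≈∑-cut-outcomes : ∀ f φ → ComponentInvariant φ →
                                    ∑-outcome-cuts f φ ≈ ∑-cut-outcomes f φ
    ∑-outcome-cuts≈∑-cut-outcomes []      φ φ-cong = sym (identityʳ _)
    ∑-outcome-cuts≈∑-cut-outcomes (t ∷ f) φ φ-cong = begin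
      ∑-outcome-cuts (t ∷ f) φ
        ≈⟨ ∑-outcomes-∷ t f _ ⟩
      ∑ (contributions t) (λ (x , y , z) → ∑ (outcomes f) λ (x′ , y′ , z′) →
        ∑ (cuts (z ++ z′)) λ (a , b) → φ (x ++ x′) (y ++ y′) a b)
        -- Cuts of a concatenation are pairs of cuts; once the sums are exchanged, outcomes and cuts
        -- of `f` stand together and the induction hypothesis applies.
        ≈⟨ ∑-cong (contributions t) (λ (x , y , z) → begin
             _ ≈⟨ ∑-cong (outcomes f) (λ (x′ , y′ , z′) → ∑-cuts-++ z z′ _) ⟩
             _ ≈⟨ ∑-swap (outcomes f) (cuts z) _ ⟩
             ∑ (cuts z) (λ (a , b) → ∑-outcome-cuts f (shift φ (x , y , a) b))
               ≈⟨ ∑-cong (cuts z) (λ (a , b) → ∑-outcome-cuts≈∑-cut-outcomes f _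
                    (λ x′ a′ b′ e → φ-cong _ _ _ (↭ᴱ.++⁺ˡ y e))) ⟩
             _ ∎) ⟩
      ∑ (contributions t) (λ (x , y , z) → ∑ (cuts z) λ (a , b) →
        ∑-cut-outcomes f (shift φ (x , y , a) b))
        -- The whole sum over `f` is now itself a weight, to which the identity for the tree `t`
        -- applies.
        ≈⟨ ∑-contributions-cuts t (λ x y a b → ∑-cut-outcomes f (shift φ (x , y , a) b))
             (λ x a b e → ∑-cong (cuts f) λ (v , w) → ∑-cong (contractions v) λ (s , p) →
               ∑-cong (outcomes w) λ (x′ , y′ , z′) → φ-cong _ _ _ (↭ᴱ.++⁺ʳ (s ++ y′) e)) ⟩
      ∑ (cutsᵗ t) (λ c → ∑-parts c λ x y a b → ∑-cut-outcomes f (shift φ (x , y , a) b))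
        ≈⟨ ∑-cong (cutsᵗ t) (λ c@(v , w) → trans
             (∑-parts-∑ c (cuts f) (λ c′ x y a b → ∑-parts c′ (shift φ (x , y , a) b)))
             (∑-cong (cuts f) λ (v′ , w′) → ∑-parts-++ v w v′ w′ φ φ-cong)) ⟩
      ∑ (cutsᵗ t) (λ (v , w) → ∑ (cuts f) λ (v′ , w′) → ∑-parts (v ++ v′ , w ++ w′) φ)
        ≈⟨ ∑-cuts-∷ t f _ ⟨
      ∑-cut-outcomes (t ∷ f) φ ∎

    -- Three kinds of terms match: the edge below `t` is cut and the contracted tree goes wholly
    -- into V; it is cut and the contracted root stays in W; it is kept, so that the root of `t`
    -- merges with the extra root. The last two reduce to the forest `ts`.
    ∑-contributions-cuts : ∀ t φ → ComponentInvariant φ →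
      ∑ (contributions t) (λ (x , y , z) → ∑ (cuts z) λ (a , b) → φ x y a b) ≈
      ∑ (cutsᵗ t) (λ c → ∑-parts c φ)
    ∑-contributions-cuts t@(node tt ts) φ φ-cong = begin
      _ ≈⟨ ∑-contributions ts _ ⟩
      ∑ (outcomes ts) (λ (x , y , z) → ∑ (cuts [ node tt z ]) λ (a , b) →
        φ [] (rootComponent x ++ y) a b) ∙ ∑-outcome-cuts ts φᵏ
        ≈⟨ ∙-congʳ (∑-cong (outcomes ts) λ (x , y , z) →
             trans (∑-cuts-[-] (node tt z) _) (∑-cutsᵗ z _)) ⟩
      _ ≈⟨ ∙-congʳ (∑-∙ (outcomes ts) _ _) ⟩
      (whole ∙ ∑-outcome-cuts ts φᶜ) ∙ ∑-outcome-cuts ts φᵏ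
        ≈⟨ assoc _ _ _ ⟩
      whole ∙ (∑-outcome-cuts ts φᶜ ∙ ∑-outcome-cuts ts φᵏ)
        ≈⟨ ∙-congˡ (∙-cong
             (∑-outcome-cuts≈∑-cut-outcomes ts φᶜ
               (λ x a b e → φ-cong _ _ _ (↭ᴱ.++⁺ˡ (rootComponent x) e)))
             (∑-outcome-cuts≈∑-cut-outcomes ts φᵏ (λ x a b e → φ-cong _ _ _ e))) ⟩
      whole ∙ (∑-cut-outcomes ts φᶜ ∙ ∑-cut-outcomes ts φᵏ)
        ≈⟨ ∙-cong whole-cut (trans (∑-cong (cuts ts) root-in-W) (∑-∙ (cuts ts) _ _)) ⟨
      ∑-parts ([ t ] , []) φ ∙ ∑ (cuts ts) (λ (v , w) → ∑-parts (v , [ node tt w ]) φ)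
        ≈⟨ ∑-cutsᵗ ts _ ⟨
      ∑ (cutsᵗ t) (λ c → ∑-parts c φ) ∎
      where
      -- `φᶜ` rebuilds the tree from data on `ts` when the edge below it is cut and its root is in
      -- W, `φᵏ` when that edge is kept.
      φᶜ φᵏ : Weight
      φᶜ x y a b = φ [] (rootComponent x ++ y) a [ node tt b ]
      φᵏ x y a b = φ [ node tt x ] y a b

      whole : Carrier
      whole = ∑ (outcomes ts) λ (x , y , z) → φ [] (rootComponent x ++ y) [ node tt z ] []

      whole-cut : ∑-parts ([ t ] , []) φ ≈ whole
      whole-cut = begin
        ∑ (contractions [ t ]) (λ (s , p) → φ [] (s ++ []) p [] ∙ ε)
          ≈⟨ ∑-contractions-[-] t _ ⟩
        _ ≈⟨ ∑-map _ (outcomes ts) _ ⟩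
        _ ≈⟨ ∑-cong (outcomes ts) (λ (x , y , z) → trans (identityʳ _)
               (φ-cong _ _ _ (↭ᴱ-Setoid.reflexive (++-identityʳ _)))) ⟩
        whole ∎

      root-in-W : ∀ c → ∑-parts (proj₁ c , [ node tt (proj₂ c) ]) φ ≈
                        ∑-parts c φᶜ ∙ ∑-parts c φᵏ
      root-in-W (v , w) = begin
        _ ≈⟨ ∑-cong (contractions v) (λ (s , p) → begin
               _ ≈⟨ ∑-outcomes-[-] (node tt w) _ ⟩
               _ ≈⟨ ∑-contributions w _ ⟩
               -- Here s precedes the component at the root of the tree; `φᶜ` expects that component
               -- first.
               _ ≈⟨ ∙-congʳ (∑-cong (outcomes w) λ (x , y , z) →
                      φ-cong [] p [ node tt z ] (↭ᴱ.shifts s (rootComponent x))) ⟩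
               _ ∎) ⟩
        _ ≈⟨ ∑-∙ (contractions v) _ _ ⟩
        ∑-parts (v , w) φᶜ ∙ ∑-parts (v , w) φᵏ ∎

  -- Outcomes that grow no branch at the extra root.

  ∑-outcomes-null : ∀ f (χ : List EdgeTree × RootedForest → Carrier) →
    ∑ (outcomes f) (λ (x , p) → guard (null x) (χ p)) ≈ ∑ (contractions f) χ
  ∑-outcomes-null []                 χ = refl
  ∑-outcomes-null (t@(node tt ts) ∷ f) χ = begin
    ∑ (outcomes (t ∷ f)) (λ (x , p) → guard (null x) (χ p))
      ≈⟨ ∑-outcomes-∷ t f _ ⟩
    _ ≈⟨ ∑-contributions ts _ ⟩
    -- A cut edge adds no branch to x and leaves the guard to the remaining trees; a kept edge adds
    -- one, so its terms vanish.
    _ ≈⟨ ∙-cong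
           (∑-cong (outcomes ts) λ (x , y , z) →
             ∑-outcomes-null f (λ q → χ (zip′ _++_ _++_ (rootComponent x ++ y , [ node tt z ]) q)))
           (trans (∑-cong (outcomes ts) λ _ → ∑-ε (outcomes f)) (∑-ε (outcomes ts))) ⟩
    _ ≈⟨ identityʳ _ ⟩
    _ ≈⟨ ∑-map _ (outcomes ts) _ ⟨
    _ ≈⟨ ∑-contractions-∷ t f χ ⟨
    ∑ (contractions (t ∷ f)) χ ∎

  -- The weight that vanishes unless x is empty selects, in 𝒪(u) and in each 𝒪(w), the outcomes that
  -- leave the extra root alone. These are the terms of Φ, so the general identity becomes the
  -- theorem for sums.
  ∑-contraction-cuts : ∀ u (ψ : List EdgeTree → RootedForest → RootedForest → Carrier) →
    (∀ {y y′} a b → y ↭ᴱ y′ → ψ y a b ≈ ψ y′ a b) →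
    ∑ (contractions u) (λ (s , p) → ∑ (cuts p) λ (a , b) → ψ s a b) ≈
    ∑ (cuts u) (λ (v , w) → ∑ (contractions v) λ (s , p) → ∑ (contractions w) λ (s′ , p′) →
      ψ (s ++ s′) p p′)
  ∑-contraction-cuts u ψ ψ-cong = begin
    ∑ (contractions u) (λ (s , p) → ∑ (cuts p) λ (a , b) → ψ s a b)
      ≈⟨ ∑-outcomes-null u _ ⟨
    _ ≈⟨ ∑-cong (outcomes u) (λ (x , y , z) → ∑-guard (null x) (cuts z) _) ⟨
    ∑-outcome-cuts u (λ x y a b → guard (null x) (ψ y a b))
      ≈⟨ ∑-outcome-cuts≈∑-cut-outcomes u _
           (λ x a b e → guard-cong (null x) λ _ → ψ-cong a b e) ⟩
    ∑-cut-outcomes u (λ x y a b → guard (null x) (ψ y a b))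
      ≈⟨ ∑-cong (cuts u) (λ (v , w) → ∑-cong (contractions v) λ (s , p) →
           ∑-outcomes-null w λ (s′ , p′) → ψ (s ++ s′) p p′) ⟩
    _ ∎

-- Passage from sums to linear maps.

module _ {c ℓ} (R : CommutativeRing c ℓ) where
  open Trees R

  ⟦⟧-∑ : ∀ {m ℓm n ℓn a} {M : Mod m ℓm} {N : Mod n ℓn} {A : Set a} (f : M ⊸ N) (xs : List A) φ →
         LeftModule._≈ᴹ_ N (⟦ f ⟧ (∑ᴹ M xs φ)) (∑ᴹ N xs (⟦ f ⟧ ∘ φ))
  ⟦⟧-∑         f []       φ = _⊸_.0ᴹ-homo f
  ⟦⟧-∑ {N = N} f (x ∷ xs) φ = ≈ᴹ-trans (_⊸_.+ᴹ-homo f _ _) (+ᴹ-congˡ (⟦⟧-∑ f xs φ))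
    where open LeftModule N

  private
    module HC = LeftModule (H ⊗ HCK)
    module CC = LeftModule (HCK ⊗ HCK)
    module HCC = LeftModule (H ⊗ (HCK ⊗ HCK))
    module ΣHC where
      open Summation HC.+ᴹ-commutativeMonoid public
      open SubforestSums HC.+ᴹ-commutativeMonoid public using (∑-subforests)
      open Sums HC.+ᴹ-commutativeMonoid public
    module ΣHCC where
      open Summation HCC.+ᴹ-commutativeMonoid public
      open Sums HCC.+ᴹ-commutativeMonoid public

  ∑-contractions : RootedForest → HC.Carrierᴹ
  ∑-contractions u = ∑ᴹ (H ⊗ HCK) (contractions u) λ (s , p) → gen s ⊗ₜ gen p

  -- On a monomial the algebra morphism Φ is a product over trees; bilinearity expands it into
  -- independent choices of a subforest in each tree.
  Φ-gen : ∀ u → ⟦ Φ ⟧ (gen u) HC.≈ᴹ ∑-contractions u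
  Φ-gen []                   = HC.≈ᴹ-sym (HC.+ᴹ-identityʳ _)
  Φ-gen (t@(node tt ts) ∷ u) = begin
    Φ-tree t * ⟦ Φ ⟧ (gen u)
      ≈⟨ *-cong (HC.≈ᴹ-trans (ΣHC.∑-subforests ts (λ y z → gen y ⊗ₜ gen [ z ]))
                  (HC.≈ᴹ-sym (ΣHC.∑-map _ (outcomes ts) (λ (s , p) → gen s ⊗ₜ gen p))))
                (Φ-gen u) ⟩
    _ ≈⟨ ⟦⟧-∑ (-* (∑-contractions u)) (contractionsᵗ t) (λ (s , p) → gen s ⊗ₜ gen p) ⟩
    ∑ᴹ (H ⊗ HCK) (contractionsᵗ t) (λ (s , p) → (gen s ⊗ₜ gen p) * ∑-contractions u)
      ≈⟨ ΣHC.∑-cong (contractionsᵗ t) (λ (s , p) →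
           ⟦⟧-∑ (*- (gen s ⊗ₜ gen p)) (contractions u) (λ (s′ , p′) → gen s′ ⊗ₜ gen p′)) ⟩
    _ ≈⟨ ΣHC.∑-contractions-∷ t u _ ⟨
    ∑-contractions (t ∷ u) ∎
    where
    open CommutativeAlgebra (𝓗 ⊗ᴬ 𝓗CK) using (_*_; *-cong; *-; -*)
    open SetoidReasoning HC.≈ᴹ-setoid

  ΔCK-gen : ∀ u → ⟦ ΔCK ⟧ (gen u) CC.≈ᴹ
            ∑ᴹ (HCK ⊗ HCK) (cuts u) λ (v , w) → gen v ⊗ₜ gen w
  ΔCK-gen u = ∑-decompositions u (λ v w → gen v ⊗ₜ gen w)
    (λ e → rel (⊗-cong {M = HCK} {N = HCK} (rel (gen-cong e)) ≋-refl))
    where open Sums CC.+ᴹ-commutativeMonoid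

  -- By linearity it suffices to compare the composites on monomials, where each unfolds to one side
  -- of `∑-contraction-cuts`.
  [id⊗ΔCK]∘Φ≗m¹³∘[Φ⊗Φ]∘ΔCK : (idₗ {M = H} ⊗₁ ΔCK) ∘ₗ Φ ≗ m¹³ ∘ₗ (Φ ⊗₁ Φ) ∘ₗ ΔCK
  [id⊗ΔCK]∘Φ≗m¹³∘[Φ⊗Φ]∘ΔCK = ⊸-ext (id⊗ΔCK ∘ₗ Φ) (m¹³ ∘ₗ (Φ ⊗₁ Φ) ∘ₗ ΔCK) λ u → begin
    ⟦ id⊗ΔCK ⟧ (⟦ Φ ⟧ (gen u))
      ≈⟨ _⊸_.⟦⟧-cong id⊗ΔCK (Φ-gen u) ⟩
    _ ≈⟨ ⟦⟧-∑ id⊗ΔCK (contractions u) _ ⟩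
    _ ≈⟨ ΣHCC.∑-cong (contractions u) (λ (s , p) → HCC.≈ᴹ-trans
           (HCC⊗.cong₂ ≋-refl (ΔCK-gen p))
           (⟦⟧-∑ (fixˡ (⊗-isBilinear {M = H} {HCK ⊗ HCK}) (gen s)) (cuts p)
             (λ (a , b) → gen a ⊗ₜ gen b))) ⟩
    ∑ᴹ (H ⊗ (HCK ⊗ HCK)) (contractions u) (λ (s , p) →
      ∑ᴹ (H ⊗ (HCK ⊗ HCK)) (cuts p) λ (a , b) → gen s ⊗ₜ (gen a ⊗ₜ gen b))
      ≈⟨ ΣHCC.∑-contraction-cuts u (λ s a b → gen s ⊗ₜ (gen a ⊗ₜ gen b))
           (λ a b e → HCC⊗.cong₂ (rel (gen-cong e)) ≋-refl) ⟩
    ∑ᴹ (H ⊗ (HCK ⊗ HCK)) (cuts u) (λ (v , w) →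
      ∑ᴹ (H ⊗ (HCK ⊗ HCK)) (contractions v) λ (s , p) →
        ∑ᴹ (H ⊗ (HCK ⊗ HCK)) (contractions w) λ (s′ , p′) →
          gen (s ++ s′) ⊗ₜ (gen p ⊗ₜ gen p′))
      ≈⟨ ΣHCC.∑-cong (cuts u) (λ (v , w) → m¹³-Φ⊗Φ v w) ⟨
    ∑ᴹ (H ⊗ (HCK ⊗ HCK)) (cuts u) (λ (v , w) → m¹³⟨ ⟦ Φ ⟧ (gen v) , ⟦ Φ ⟧ (gen w) ⟩)
      ≈⟨ ⟦⟧-∑ (m¹³ ∘ₗ (Φ ⊗₁ Φ)) (cuts u) (λ (v , w) → gen v ⊗ₜ gen w) ⟨
    _ ≈⟨ _⊸_.⟦⟧-cong (m¹³ ∘ₗ (Φ ⊗₁ Φ)) (ΔCK-gen u) ⟨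
    ⟦ m¹³ ∘ₗ (Φ ⊗₁ Φ) ⟧ (⟦ ΔCK ⟧ (gen u)) ∎
    where
    open SetoidReasoning HCC.≈ᴹ-setoid
    module HCC⊗ = IsBilinear (⊗-isBilinear {M = H} {HCK ⊗ HCK})
    module m¹³ = IsBilinear (⊸-isBilinear m¹³)

    id⊗ΔCK : H ⊗ HCK ⊸ H ⊗ (HCK ⊗ HCK)
    id⊗ΔCK = idₗ {M = H} ⊗₁ ΔCK

    m¹³⟨_,_⟩ : HC.Carrierᴹ → HC.Carrierᴹ → HCC.Carrierᴹ
    m¹³⟨ x , y ⟩ = ⟦ m¹³ ⟧ (x ⊗ₜ y)

    m¹³-Φ⊗Φ : ∀ v w → m¹³⟨ ⟦ Φ ⟧ (gen v) , ⟦ Φ ⟧ (gen w) ⟩ HCC.≈ᴹ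
      (∑ᴹ (H ⊗ (HCK ⊗ HCK)) (contractions v) λ (s , p) →
        ∑ᴹ (H ⊗ (HCK ⊗ HCK)) (contractions w) λ (s′ , p′) →
          gen (s ++ s′) ⊗ₜ (gen p ⊗ₜ gen p′))
    m¹³-Φ⊗Φ v w = begin
      m¹³⟨ ⟦ Φ ⟧ (gen v) , ⟦ Φ ⟧ (gen w) ⟩
        ≈⟨ m¹³.cong₂ (Φ-gen v) (Φ-gen w) ⟩
      _ ≈⟨ ⟦⟧-∑ (fixʳ (⊸-isBilinear m¹³) (∑-contractions w)) (contractions v)
             (λ (s , p) → gen s ⊗ₜ gen p) ⟩
      ∑ᴹ (H ⊗ (HCK ⊗ HCK)) (contractions v) (λ (s , p) → m¹³⟨ gen s ⊗ₜ gen p , ∑-contractions w ⟩)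
        ≈⟨ ΣHCC.∑-cong (contractions v) (λ (s , p) →
             ⟦⟧-∑ (fixˡ (⊸-isBilinear m¹³) (gen s ⊗ₜ gen p)) (contractions w)
               (λ (s′ , p′) → gen s′ ⊗ₜ gen p′)) ⟩
      -- On generators `m¹³` and the product of 𝓗 compute, so the remaining sums agree by
      -- definition.
      _ ∎

mainTheorem4 : ∀ {c ℓ₁ ℓ₂} (K : HeytingField c ℓ₁ ℓ₂) → CharacteristicZero K →
    let open Trees (fieldRing K) in
    (idₗ {M = H} ⊗₁ ΔCK) ∘ₗ Φ ≗ m¹³ ∘ₗ (Φ ⊗₁ Φ) ∘ₗ ΔCK
mainTheorem4 K _ = [id⊗ΔCK]∘Φ≗m¹³∘[Φ⊗Φ]∘ΔCK (fieldRing K)
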